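{- A graph $G$ is chordal and contains neither the claw nor the 3-sun as an induced subgraph if and only if $G$ is an NC-path-r.tree graph. Moreover, a graph has an NC-path-d.tree model if and only if it has an NC-path-r.tree model that is a clique tree.
   Context: All graphs are finite, simple, loopless, undirected and connected. A graph is chordal if it has no induced cycle of length at least four. The claw is $K_{1,3}$. The 3-sun is the six-vertex graph consisting of a triangle $v_1v_2v_3$ and three pairwise non-adjacent vertices $u_1,u_2,u_3$, where $u_i$ is adjacent to exactly the two triangle vertices other than $v_i$. A directed tree (d.tree) is a tree in which every edge has been assigned one direction. A rooted tree (r.tree) is a directed tree with exactly one source node, the root, such that all edges are directed away from the root. A path-d.tree model (resp. path-r.tree model) of $G$ is a pair $(\{P_v\}_{v\in V(G)},T)$ where $T=\bigcup_{v\in V(G)} P_v$ is a directed tree (resp. rooted tree), each $P_v$ is a directed path of $T$ (possibly a single node), and for distinct $u,v\in V(G)$, $uv\in E(G)$ if and only if $P_u$ and $P_v$ share a node. Two paths $P_u,P_v$ are non-crossing if both $P_u\setminus P_v$ and $P_v\setminus P_u$ (obtained by deleting the nodes of the other path) are connected, where the empty set counts as connected. The model is an NC-path-d.tree (resp. NC-path-r.tree) model if the paths are pairwise non-crossing; $G$ is an NC-path-r.tree graph if it has an NC-path-r.tree model. Such a model is a clique tree if the nodes of $T$ are in bijection with the maximal cliques of $G$, each node $x$ corresponding to the maximal clique $\{v\in V(G): x\in P_v\}$. -}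

module Defs where

open import Data.Empty using (⊥)
open import Data.Fin using (Fin; zero; suc; toℕ; fromℕ)
open import Data.Fin.Properties using (_≟_)
open import Data.Fin.Subset as Subset using (Subset)
open import Data.List using (List; _∷_; zip)
open import Data.List.Membership.DecPropositional using (_∈?_)
open import Data.List.Membership.Propositional using (_∈_; _∉_)
open import Data.List.Relation.Unary.Linked using (Linked)
open import Data.List.Relation.Unary.Unique.Propositional using (Unique)
open import Data.Nat as ℕ using (ℕ; _+_)
import Data.Nat.Properties as ℕ
open import Data.Product using (_×_; _,_; ∃-syntax; Σ-syntax)
open import Data.Sum using (_⊎_; inj₁; inj₂; swap)
open import Data.Unit using (⊤; tt)
open import Data.Vec using (tabulate)
open import Function.Bundles using (_⇔_)
open import Function.Definitions using (Injective)
open import Level using (0ℓ)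
open import Relation.Binary using (Rel; Asymmetric; Decidable; Irreflexive; Symmetric)
open import Relation.Binary.Construct.Closure.ReflexiveTransitive using (Star)
open import Relation.Binary.Construct.Closure.Symmetric using (SymClosure)
open import Relation.Binary.PropositionalEquality
  using (_≡_; _≢_; refl; sym)
open import Relation.Nullary using (¬_; yes; no; does; ¬?; _×-dec_; _⊎-dec_)

private
  variable
    V W : Set
    n : ℕ

------------------------------------------------------------------------
-- Graphs

record Graph (V : Set) : Set₁ where
  field
    Adj     : Rel V 0ℓ
    adj?    : Decidable Adj
    adj-sym : Symmetric Adj
    adj-irr : Irreflexive _≡_ Adj

open Graph public

-- A connected graph has at least one vertex.
Connected : Graph V → Set
Connected {V} G = V × (∀ u v → Star (Adj G) u v)

infix 4 _⊆ᵍ_ _⊆ⁱ_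

-- H is isomorphic to a (not necessarily induced) subgraph of G.
_⊆ᵍ_ : Graph V → Graph W → Set
_⊆ᵍ_ {V} {W} H G =
  Σ[ f ∈ (V → W) ] Injective _≡_ _≡_ f
                 × (∀ x y → Adj H x y → Adj G (f x) (f y))

-- H is isomorphic to an induced subgraph of G.
_⊆ⁱ_ : Graph V → Graph W → Set
_⊆ⁱ_ {V} {W} H G =
  Σ[ f ∈ (V → W) ] Injective _≡_ _≡_ f
                 × (∀ x y → Adj H x y ⇔ Adj G (f x) (f y))

Next : ∀ k → Rel (Fin (3 + k)) 0ℓ
Next k i j = toℕ j ≡ ℕ.suc (toℕ i) ⊎ (i ≡ fromℕ (2 + k) × j ≡ zero)

-- The cycle of length 3 + k.
cycle : ∀ k → Graph (Fin (3 + k))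
cycle k = record
  { Adj     = λ i j → Next k i j ⊎ Next k j i
  ; adj?    = λ i j → next? i j ⊎-dec next? j i
  ; adj-sym = swap
  ; adj-irr = λ { refl (inj₁ p) → next-irr p ; refl (inj₂ p) → next-irr p }
  }
  where
  next? : Decidable (Next k)
  next? i j = (toℕ j ℕ.≟ ℕ.suc (toℕ i)) ⊎-dec ((i ≟ fromℕ (2 + k)) ×-dec (j ≟ zero))

  next-irr : ∀ {i} → ¬ Next k i i
  next-irr (inj₁ p) = ℕ.1+n≢n (sym p)
  next-irr (inj₂ (refl , ()))

-- K₁,₃ with centre zero.
claw : Graph (Fin 4)
claw = record { Adj = A ; adj? = A? ; adj-sym = λ {i} {j} → A-sym i j ; adj-irr = λ { {i} refl → A-irr i } }
  where
  A : Rel (Fin 4) 0ℓ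
  A zero    (suc _) = ⊤
  A (suc _) zero    = ⊤
  A zero    zero    = ⊥
  A (suc _) (suc _) = ⊥

  A? : Decidable A
  A? zero    (suc _) = yes tt
  A? (suc _) zero    = yes tt
  A? zero    zero    = no λ ()
  A? (suc _) (suc _) = no λ ()

  A-sym : ∀ i j → A i j → A j i
  A-sym zero    (suc _) _ = tt
  A-sym (suc _) zero    _ = tt

  A-irr : ∀ i → ¬ A i i
  A-irr zero    ()
  A-irr (suc _) ()

-- inj₁ i is the triangle vertex vᵢ and inj₂ i is the independent vertex uᵢ.
3-sun : Graph (Fin 3 ⊎ Fin 3)
3-sun = record { Adj = A ; adj? = A? ; adj-sym = λ {x} {y} → A-sym x y ; adj-irr = λ { {x} refl → A-irr x } }
  where
  A : Rel (Fin 3 ⊎ Fin 3) 0ℓ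
  A (inj₁ i) (inj₁ j) = i ≢ j
  A (inj₁ i) (inj₂ j) = i ≢ j
  A (inj₂ i) (inj₁ j) = i ≢ j
  A (inj₂ _) (inj₂ _) = ⊥

  A? : Decidable A
  A? (inj₁ i) (inj₁ j) = ¬? (i ≟ j)
  A? (inj₁ i) (inj₂ j) = ¬? (i ≟ j)
  A? (inj₂ i) (inj₁ j) = ¬? (i ≟ j)
  A? (inj₂ _) (inj₂ _) = no λ ()

  A-sym : ∀ x y → A x y → A y x
  A-sym (inj₁ _) (inj₁ _) p q = p (sym q)
  A-sym (inj₁ _) (inj₂ _) p q = p (sym q)
  A-sym (inj₂ _) (inj₁ _) p q = p (sym q)

  A-irr : ∀ x → ¬ A x x
  A-irr (inj₁ _) p = p refl
  A-irr (inj₂ _) ()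

Chordal : Graph V → Set
Chordal G = ∀ k → ¬ (cycle (1 + k) ⊆ⁱ G)

ClawFree : Graph V → Set
ClawFree G = ¬ (claw ⊆ⁱ G)

3-SunFree : Graph V → Set
3-SunFree G = ¬ (3-sun ⊆ⁱ G)

IsClique : Graph (Fin n) → Subset n → Set
IsClique G S = ∀ {u v} → u Subset.∈ S → v Subset.∈ S → u ≢ v → Adj G u v

IsMaximalClique : Graph (Fin n) → Subset n → Set
IsMaximalClique G S = IsClique G S × (∀ S′ → IsClique G S′ → S Subset.⊆ S′ → S′ ≡ S)

------------------------------------------------------------------------
-- Directed and rooted trees

Acyclic : Graph V → Set
Acyclic G = ∀ k → ¬ (cycle k ⊆ᵍ G)

IsTree : Graph V → Set
IsTree G = Connected G × Acyclic G

record DirectedTree (V : Set) : Set₁ where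
  field
    graph   : Graph V
    isTree  : IsTree graph
    Arc     : Rel V 0ℓ
    arc-adj : ∀ {x y} → Arc x y → Adj graph x y
    orient  : ∀ {x y} → Adj graph x y → Arc x y ⊎ Arc y x
    asym    : Asymmetric Arc

open DirectedTree public

IsSource : DirectedTree V → V → Set
IsSource T x = ∀ y → ¬ Arc T y x

record IsRooted (T : DirectedTree V) : Set where
  field
    root   : V
    source : IsSource T root
    unique : ∀ x → IsSource T x → x ≡ root
    -- All edges point away from the root: the tree path from the root to
    -- any node is a directed path.
    away   : ∀ x → Star (Arc T) root x

record DirectedPath (T : DirectedTree V) : Set where
  field
    first : V
    rest  : List V

  nodes : List V
  nodes = first ∷ rest

  -- The pairs of consecutive nodes.
  arcs : List (V × V)
  arcs = zip nodes rest

  field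
    linked   : Linked (Arc T) nodes
    distinct : Unique nodes

open DirectedPath public

-- P ∖ Q is the graph obtained from the path P by deleting the nodes of Q.
DifferenceConnected : {T : DirectedTree V} → DirectedPath T → DirectedPath T → Set
DifferenceConnected P Q =
  ∀ {x y} → x ∈ nodes P → x ∉ nodes Q → y ∈ nodes P → y ∉ nodes Q → Star Step x y
  where
  Step : Rel _ 0ℓ
  Step a b = a ∉ nodes Q × b ∉ nodes Q × SymClosure (λ c d → (c , d) ∈ arcs P) a b

NonCrossing : {T : DirectedTree V} → DirectedPath T → DirectedPath T → Set
NonCrossing P Q = DifferenceConnected P Q × DifferenceConnected Q P

------------------------------------------------------------------------
-- Models

record PathDTreeModel (G : Graph (Fin n)) : Set₁ where
  field
    size : ℕ
    tree : DirectedTree (Fin size)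
    path : Fin n → DirectedPath tree
    -- The tree is the union of the paths, as a graph.
    node-covered : ∀ x → ∃[ v ] x ∈ nodes (path v)
    arc-covered  : ∀ {x y} → Arc tree x y → ∃[ v ] (x , y) ∈ arcs (path v)
    intersection : ∀ u v → u ≢ v →
      Adj G u v ⇔ (∃[ x ] (x ∈ nodes (path u) × x ∈ nodes (path v)))

  -- {v ∈ V(G) : x ∈ Pᵥ}
  bag : Fin size → Subset n
  bag x = tabulate λ v → does (_∈?_ _≟_ x (nodes (path v)))

open PathDTreeModel public

module _ {G : Graph (Fin n)} where

  IsRTreeModel : PathDTreeModel G → Set
  IsRTreeModel M = IsRooted (tree M)

  IsNC : PathDTreeModel G → Set
  IsNC M = ∀ u v → u ≢ v → NonCrossing (path M u) (path M v)

  -- bag is a bijection from the nodes onto the maximal cliques.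
  record IsCliqueTree (M : PathDTreeModel G) : Set where
    field
      maximal    : ∀ x → IsMaximalClique G (bag M x)
      injective  : Injective _≡_ _≡_ (bag M)
      surjective : ∀ S → IsMaximalClique G S → ∃[ x ] bag M x ≡ S

HasNCPathDTreeModel : Graph (Fin n) → Set₁
HasNCPathDTreeModel G = Σ[ M ∈ PathDTreeModel G ] IsNC M

IsNCPathRTreeGraph : Graph (Fin n) → Set₁
IsNCPathRTreeGraph G = Σ[ M ∈ PathDTreeModel G ] (IsRTreeModel M × IsNC M)

HasNCPathRTreeCliqueTree : Graph (Fin n) → Set₁
HasNCPathRTreeCliqueTree G =
  Σ[ M ∈ PathDTreeModel G ] (IsRTreeModel M × IsNC M × IsCliqueTree M)

{-# OPTIONS --safe #-}
module Submission where

-- For the forbidden subgraphs, let T be the tree of a model. Three pairwise intersecting connected node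
-- sets of T, one of them a path, have a common node: otherwise some edge of the path would not be a
-- bridge. On a hole this is applied to a path, the next one and the union of all others.
--
-- Conversely, inserting the vertices in reverse along a perfect elimination order that ends in a
-- simplicial vertex r of G gives a clique tree whose root bag contains r. For every tree edge tx,
-- maximality puts a vertex in bag x that is not in bag t, and such vertices of distinct neighbours of t
-- are non-adjacent. If a vertex v passes through node t from neighbour a to neighbour b and t had
-- a third neighbour c, connectedness of G would give a vertex in bags t and c; claw-freeness then forces
-- paths through all three pairs of a, b, c, which is a 3-sun. No path passes through the root, because
-- of r. Hence every vertex occupies a descending path, and these paths do not cross, by claw-freeness.

open import Defs
open import Data.Empty using (⊥; ⊥-elim)
open import Data.Fin using (Fin; zero; suc; toℕ; fromℕ; inject₁; lower₁)
open import Data.Fin.Properties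
  using (_≟_; toℕ-injective; toℕ-fromℕ; toℕ-inject₁; toℕ-lower₁; suc-injective; 0≢1+n)
  renaming (any? to anyFin?)
import Data.Fin.Subset as Subset
import Data.Fin.Subset.Properties as Subset
open import Data.List using (List; []; _∷_; _++_; length; lookup; zip; filter; allFin; map)
open import Data.List.Membership.DecPropositional using (_∈?_)
open import Data.List.Membership.Propositional using (_∈_; _∉_; find; lose)
open import Data.List.Membership.Propositional.Properties
  using (∈-lookup; ∈-filter⁺; ∈-filter⁻; ∈-allFin; ∈-map⁺; ∈-map⁻; ∈-++⁺ˡ; ∈-++⁺ʳ; ∈-++⁻)
open import Data.List.Properties using (filter-notAll)
open import Data.List.Relation.Unary.All as All using (All; []; _∷_)
open import Data.List.Relation.Unary.All.Properties using (¬Any⇒All¬)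
open import Data.List.Relation.Unary.AllPairs as AllPairs using (_∷_; [])
open import Data.List.Relation.Unary.Any as Any using (Any; here; there; any?)
open import Data.List.Relation.Unary.Linked as Linked using (Linked; []; [-]; _∷_)
import Data.List.Relation.Unary.Linked.Properties as Linked
open import Data.List.Relation.Unary.Unique.Propositional using (Unique)
open import Data.Nat as ℕ using (ℕ; _+_; _<_; _≤_; z≤n; s≤s)
import Data.Nat.Properties as ℕ
open import Data.Product using (_×_; _,_; proj₁; proj₂; ∃-syntax; Σ-syntax)
open import Data.Sum as Sum using (_⊎_; inj₁; inj₂; swap)
open import Data.Unit using (⊤; tt)
open import Data.Vec.Properties using (lookup∘tabulate; lookup⇒[]=; []=⇒lookup)
open import Function using (_∘_; id)
open import Function.Bundles using (_⇔_; mk⇔; Equivalence)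
open import Level using (0ℓ)
open import Relation.Binary using (Rel; Decidable; DecidableEquality; Symmetric; tri<; tri≈; tri>)
open import Relation.Binary.Construct.Closure.ReflexiveTransitive as Star using (Star; ε; _◅_; _◅◅_)
open import Relation.Binary.Construct.Closure.Symmetric using (SymClosure; fwd; bwd)
open import Relation.Binary.PropositionalEquality using (_≡_; _≢_; refl; sym; trans; cong; subst)
open import Relation.Nullary using (¬_; yes; no; does; _⊎-dec_; _×-dec_; ¬?; decidable-stable)
open import Relation.Unary using () renaming (Decidable to Decidable₁)

-- The three forbidden subgraphs contradict different properties of a model: a hole contradicts the
-- connectedness of the paths inside a tree, the 3-sun their directedness, and the claw that they do
-- not cross. For the converse the obstacle is a vertex whose set of nodes contains two children of
-- one node. Below the root, the parent serves as the third neighbour. The root has no parent, and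
-- this is why its bag is chosen to contain a simplicial vertex `r`: such a vertex belongs to a
-- single maximal clique, so its only node is the root, whereas a vertex passing through the root
-- would force, by claw-freeness, every vertex of the root bag into one of the two neighbouring
-- bags.

-- Induced paths extracted from walks

Apart : {V : Set} → Rel V 0ℓ → Rel V 0ℓ
Apart R a z = a ≢ z × ¬ R a z

-- The list holds the vertices of the path after its first one.
data InducedPath {V : Set} (R : Rel V 0ℓ) : V → V → List V → Set where
  []  : ∀ {a} → InducedPath R a a []
  cons : ∀ {a b c l} → R a c → a ≢ c → All (Apart R a) l →
         InducedPath R c b l → InducedPath R a b (c ∷ l)

module _ {V : Set} (_≟_ : DecidableEquality V) {R : Rel V 0ℓ} (R? : Decidable R) where

  Near : V → V → Set
  Near a z = a ≡ z ⊎ R a z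

  near? : Decidable Near
  near? a z = (a ≟ z) ⊎-dec R? a z

  -- Jumping from `a` to the last vertex of the path that is near it leaves only vertices apart from
  -- `a` behind that one, so the path stays induced. If that last vertex is `a` itself, this erases
  -- a loop.
  shortcut : ∀ {P : V → Set} a {h b l} → InducedPath R h b l → All P (h ∷ l) →
             Any (Near a) (h ∷ l) → ∃[ l′ ] (InducedPath R a b l′ × All P l′)
  shortcut a {l = l} p (ph ∷ pl) near with any? (near? a) l
  shortcut a (cons _ _ _ p) (ph ∷ pl) near | yes near′ = shortcut a p pl near′
  shortcut a p (ph ∷ pl) (there near) | no far = ⊥-elim (far near)
  shortcut a p (ph ∷ pl) (here (inj₁ refl)) | no far = _ , p , pl
  shortcut a {h} {l = l} p (ph ∷ pl) (here (inj₂ r)) | no far with a ≟ h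
  ... | yes refl = _ , p , pl
  ... | no a≢h = _ , cons r a≢h (All.map (λ ¬near → ¬near ∘ inj₁ , ¬near ∘ inj₂) (¬Any⇒All¬ l far)) p
               , ph ∷ pl

  -- `P` is asked only of the targets of the steps, so that it may fail at the start `a`.
  inducedPath : ∀ {P : V → Set} {a b} → Star (λ x y → R x y × P y) a b →
                ∃[ l ] (InducedPath R a b l × All P l)
  inducedPath ε = [] , [] , []
  inducedPath {a = a} ((r , py) ◅ w) with inducedPath w
  ... | l , p , pl = shortcut a p (py ∷ pl) (here (inj₂ r))

module _ {V : Set} {R : Rel V 0ℓ} where

  private
    variable
      a b : V
      l : List V

  path-step : InducedPath R a b l → ∀ i j → toℕ j ≡ ℕ.suc (toℕ i) →
              R (lookup (a ∷ l) i) (lookup (a ∷ l) j)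
  path-step (cons r _ _ _) zero (suc zero) _ = r
  path-step (cons _ _ _ p) (suc i) (suc j) eq = path-step p i j (ℕ.suc-injective eq)

  path-distinct : InducedPath R a b l → ∀ i j → toℕ i < toℕ j →
                  lookup (a ∷ l) i ≢ lookup (a ∷ l) j
  path-distinct (cons _ a≢c _ _) zero (suc zero) _ = a≢c
  path-distinct (cons {l = l} _ _ far _) zero (suc (suc j)) _ = proj₁ (All.lookup far (∈-lookup {xs = l} j))
  path-distinct (cons _ _ _ p) (suc i) (suc j) (s≤s i<j) = path-distinct p i j i<j

  path-far : InducedPath R a b l → ∀ i j → ℕ.suc (toℕ i) < toℕ j →
             ¬ R (lookup (a ∷ l) i) (lookup (a ∷ l) j)
  path-far (cons _ _ _ _) zero (suc zero) (s≤s ())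
  path-far (cons {l = l} _ _ far _) zero (suc (suc j)) _ = proj₂ (All.lookup far (∈-lookup {xs = l} j))
  path-far (cons _ _ _ p) (suc i) (suc j) (s≤s i<j) = path-far p i j i<j

  path-injective : InducedPath R a b l → ∀ i j → lookup (a ∷ l) i ≡ lookup (a ∷ l) j → i ≡ j
  path-injective p i j eq with ℕ.<-cmp (toℕ i) (toℕ j)
  ... | tri< i<j _ _ = ⊥-elim (path-distinct p i j i<j eq)
  ... | tri≈ _ i≡j _ = toℕ-injective i≡j
  ... | tri> _ _ j<i = ⊥-elim (path-distinct p j i j<i (sym eq))

  path-last : InducedPath R a b l → lookup (a ∷ l) (fromℕ (length l)) ≡ b
  path-last [] = refl
  path-last (cons _ _ _ p) = path-last p

-- Connected sets and paths in a tree

module _ {V : Set} (_≟_ : DecidableEquality V) (T : Graph V) where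

  ConnectedIn : (V → Set) → Set
  ConnectedIn S = ∀ {x y} → S x → S y → Star (λ a b → Adj T a b × S a × S b) x y

  SameEdge : V → V → V → V → Set
  SameEdge x y a b = (a ≡ x × b ≡ y) ⊎ (a ≡ y × b ≡ x)

  Off : V → V → Rel V 0ℓ
  Off x y a b = Adj T a b × ¬ SameEdge x y a b

  off? : ∀ x y → Decidable (Off x y)
  off? x y a b = adj? T a b ×-dec ¬? (((a ≟ x) ×-dec (b ≟ y)) ⊎-dec ((a ≟ y) ×-dec (b ≟ x)))

  off-sym : ∀ {x y} → Symmetric (Off x y)
  off-sym (r , ¬e) = adj-sym T r , λ { (inj₁ (p , q)) → ¬e (inj₂ (q , p)) ; (inj₂ (p , q)) → ¬e (inj₁ (q , p)) }

  -- Together with `bridge` this is the usual way to contradict acyclicity: walks inside connected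
  -- sets, each missing an end of an edge, are concatenated to a walk between the ends of that edge.
  off : ∀ {S : V → Set} {x y a b} → ¬ (S x × S y) → Star (λ a b → Adj T a b × S a × S b) a b →
        Star (Off x y) a b
  off ¬xy = Star.map λ (r , sa , sb) → r , λ { (inj₁ (refl , refl)) → ¬xy (sa , sb)
                                            ; (inj₂ (refl , refl)) → ¬xy (sb , sa) }

  union-connected : ∀ {S S′ : V → Set} → ConnectedIn S → ConnectedIn S′ → ∀ {z} → S z → S′ z →
                    ConnectedIn (λ x → S x ⊎ S′ x)
  union-connected {S} {S′} con con′ {z} sz sz′ p q =
    to p ◅◅ Star.reverse (λ { (r , a , b) → adj-sym T r , b , a }) (to q)
    where
    to : ∀ {x} → S x ⊎ S′ x → Star (λ a b → Adj T a b × (S a ⊎ S′ a) × (S b ⊎ S′ b)) x z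
    to (inj₁ s) = Star.map (λ { (r , a , b) → r , inj₁ a , inj₁ b }) (con s sz)
    to (inj₂ s) = Star.map (λ { (r , a , b) → r , inj₂ a , inj₂ b }) (con′ s sz′)

  chain-connected : ∀ {m} (S : Fin (ℕ.suc m) → V → Set) → (∀ i → ConnectedIn (S i)) →
                    (∀ i j → toℕ j ≡ ℕ.suc (toℕ i) → ∃[ x ] (S i x × S j x)) →
                    ConnectedIn (λ x → ∃[ i ] S i x)
  chain-connected {ℕ.zero} S con _ (zero , p) (zero , q) =
    Star.map (λ { (r , a , b) → r , (_ , a) , (_ , b) }) (con zero p q)
  chain-connected {ℕ.suc m} S con meet p q with meet zero (suc zero) refl
  ... | x , s , s′ = Star.map (λ { (r , a , b) → r , back a , back b })
      (union-connected (con zero)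
        (chain-connected (S ∘ suc) (con ∘ suc) λ i j eq → meet (suc i) (suc j) (cong ℕ.suc eq))
        s (zero , s′) (split p) (split q))
    where
    split : ∀ {x} → ∃[ i ] S i x → S zero x ⊎ (∃[ i ] S (suc i) x)
    split (zero , s) = inj₁ s
    split (suc i , s) = inj₂ (i , s)

    back : ∀ {x} → S zero x ⊎ (∃[ i ] S (suc i) x) → ∃[ i ] S i x
    back (inj₁ s) = _ , s
    back (inj₂ (i , s)) = _ , s

  list-walk : ∀ {h t x} → Linked (Adj T) (h ∷ t) → x ∈ h ∷ t →
              Star (λ a b → Adj T a b × a ∈ h ∷ t × b ∈ h ∷ t) h x
  list-walk _ (here refl) = ε
  list-walk (r ∷ lk) (there x∈t) =
    (r , here refl , there (here refl))
    ◅ Star.map (λ { (r , a , b) → r , there a , there b }) (list-walk lk x∈t)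

  list-connected : ∀ {l} → Linked (Adj T) l → ConnectedIn (_∈ l)
  list-connected {_ ∷ _} lk p q =
    Star.reverse (λ { (r , a , b) → adj-sym T r , b , a }) (list-walk lk p) ◅◅ list-walk lk q

  -- Loop erasure turns a walk avoiding the edge xy into a cycle through it.
  bridge : Acyclic T → ∀ {x y} → Adj T x y → ¬ Star (Off x y) x y
  bridge acyclic {x} {y} xy w with inducedPath _≟_ (off? x y) {P = λ _ → y ≡ y} (Star.map (_, refl) w)
  ... | [] , [] , _ = adj-irr T refl xy
  ... | _ ∷ [] , cons (_ , ¬e) _ _ [] , _ = ¬e (inj₁ (refl , refl))
  ... | l@(c ∷ d ∷ l′) , p , _ = 
    acyclic (length l′) (lookup (x ∷ l) , (λ {i} {j} → path-injective p i j) , edges)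
    where
    next : ∀ i j → Next (length l′) i j → Adj T (lookup (x ∷ l) i) (lookup (x ∷ l) j)
    next i j (inj₁ eq) = proj₁ (path-step p i j eq)
    next i j (inj₂ (refl , refl)) = subst (λ z → Adj T z x) (sym (path-last p)) (adj-sym T xy)

    edges : ∀ i j → Adj (cycle (length l′)) i j → Adj T (lookup (x ∷ l) i) (lookup (x ∷ l) j)
    edges i j (inj₁ e) = next i j e
    edges i j (inj₂ e) = adj-sym T (next j i e)

-- Order along a list

data Before {V : Set} (x y : V) : List V → Set where
  here  : ∀ {l} → y ∈ l → Before x y (x ∷ l)
  there : ∀ {h l} → Before x y l → Before x y (h ∷ l)

module _ {V : Set} where

  private
    variable
      x y z : V
      l : List V

  before-∈ˡ : Before x y l → x ∈ l
  before-∈ˡ (here _) = here refl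
  before-∈ˡ (there p) = there (before-∈ˡ p)

  before-∈ʳ : Before x y l → y ∈ l
  before-∈ʳ (here p) = there p
  before-∈ʳ (there p) = there (before-∈ʳ p)

  before-cmp : x ∈ l → y ∈ l → x ≢ y → Before x y l ⊎ Before y x l
  before-cmp (here refl) (here refl) x≢y = ⊥-elim (x≢y refl)
  before-cmp (here refl) (there q) _ = inj₁ (here q)
  before-cmp (there p) (here refl) _ = inj₂ (here p)
  before-cmp (there p) (there q) x≢y with before-cmp p q x≢y
  ... | inj₁ b = inj₁ (there b)
  ... | inj₂ b = inj₂ (there b)

  before-head : y ∈ x ∷ l → y ≡ x ⊎ Before x y (x ∷ l)
  before-head (here e) = inj₁ e
  before-head (there p) = inj₂ (here p)

  before-irrefl : Unique l → ¬ Before x x l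
  before-irrefl (u ∷ _) (here p) = All.lookup u p refl
  before-irrefl (_ ∷ u) (there p) = before-irrefl u p

  before-asym : Unique l → Before x y l → ¬ Before y x l
  before-asym u (here p) (here q) = before-irrefl u (here p)
  before-asym (u ∷ _) (here p) (there b) = All.lookup u (before-∈ʳ b) refl
  before-asym (u ∷ _) (there b) (here q) = All.lookup u (before-∈ʳ b) refl
  before-asym (_ ∷ u) (there a) (there b) = before-asym u a b

  before-trans : Unique l → Before x y l → Before y z l → Before x z l
  before-trans u (here p) (here q) = here q
  before-trans u (here p) (there q) = here (before-∈ʳ q)
  before-trans (u ∷ _) (there p) (here q) = ⊥-elim (All.lookup u (before-∈ʳ p) refl)
  before-trans (_ ∷ u) (there p) (there q) = there (before-trans u p q)

-- Convexity and the Helly property in a tree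

module _ {V : Set} (_≟_ : DecidableEquality V) (T : Graph V) (acyclic : Acyclic T) where

  -- If `Q` contained `h` and `b` but not the node `h′` after `h`, the walk from `h` to `b` inside
  -- `Q`, followed by the path backwards from `b` to `h′`, would bypass the edge from `h` to `h′`.
  convex : ∀ {l} → Linked (Adj T) l → Unique l → ∀ {Q : V → Set} → Decidable₁ Q → ConnectedIn _≟_ T Q →
           ∀ {a z b} → Before a z l → Before z b l → Q a → Q b → Q z
  convex (r ∷ lk) (u ∷ us) Q? con (there az) (there zb) qa qb = convex lk us Q? con az zb qa qb
  convex (r ∷ lk) (u ∷ us) Q? con (here z∈) (here b∈) qa qb = qa
  convex (r ∷ lk) (u ∷ us) Q? con (there az) (here b∈) qa qb = ⊥-elim (All.lookup u (before-∈ʳ az) refl)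
  convex {h ∷ h′ ∷ t} (r ∷ lk) (u ∷ us) Q? con (here z∈) (there zb) qa qb with Q? h′ | z∈
  ... | yes qh′ | here refl = qh′
  ... | yes qh′ | there z∈′ = convex lk us Q? con (here z∈′) zb qh′ qb
  ... | no ¬qh′ | _ = ⊥-elim (bridge _≟_ T acyclic r
    (off _≟_ T (¬qh′ ∘ proj₂) (con qa qb)
    ◅◅ Star.reverse (off-sym _≟_ T)
         (off _≟_ T (λ (h∈ , _) → All.lookup u h∈ refl) (list-walk _≟_ T lk (before-∈ʳ zb)))))

  private
    -- The path is followed as long as it stays in `Q`. Suppose it leaves `Q` from `h` to `h′` with
    -- `h` outside `R`. Then that edge is bypassed by going to `c` inside `Q`, on to `b` inside `R`,
    -- and back along the path to `h′`.
    helly-before : ∀ {l} → Linked (Adj T) l → Unique l → ∀ {Q R : V → Set} → Decidable₁ Q → Decidable₁ R →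
                   ConnectedIn _≟_ T Q → ConnectedIn _≟_ T R → ∀ {a b c} → Before a b l → Q a → R b → Q c →
                   R c →
                   ∃[ x ] (x ∈ l × Q x × R x)
    helly-before (r ∷ lk) (u ∷ us) Q? R? conQ conR (there ab) qa rb qc rc
      with helly-before lk us Q? R? conQ conR ab qa rb qc rc
    ... | x , x∈ , qr = x , there x∈ , qr
    helly-before {h ∷ h′ ∷ t} (r ∷ lk) (u ∷ us) Q? R? conQ conR (here b∈) qa rb qc rc with R? h | Q? h′ | b∈
    ... | yes rh | _ | _ = h , here refl , qa , rh
    ... | no _ | yes qh′ | here refl = h′ , there (here refl) , qh′ , rb
    ... | no _ | yes qh′ | there b∈′ with helly-before lk us Q? R? conQ conR (here b∈′) qh′ rb qc rc
    ...   | x , x∈ , qr = x , there x∈ , qr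
    helly-before {h ∷ h′ ∷ t} (r ∷ lk) (u ∷ us) Q? R? conQ conR (here b∈) qa rb qc rc | no ¬rh | no ¬qh′ | _ =
      ⊥-elim (bridge _≟_ T acyclic r
        (off _≟_ T (¬qh′ ∘ proj₂) (conQ qa qc) ◅◅ off _≟_ T (¬rh ∘ proj₁) (conR rc rb)
        ◅◅ Star.reverse (off-sym _≟_ T)
             (off _≟_ T (λ (h∈ , _) → All.lookup u h∈ refl) (list-walk _≟_ T lk b∈))))

  helly : ∀ {l} → Linked (Adj T) l → Unique l → ∀ {Q R : V → Set} → Decidable₁ Q → Decidable₁ R →
          ConnectedIn _≟_ T Q → ConnectedIn _≟_ T R → ∀ {a b c} → a ∈ l → Q a → b ∈ l → R b → Q c → R c →
          ∃[ x ] (x ∈ l × Q x × R x)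
  helly lk us Q? R? conQ conR {a} {b} a∈ qa b∈ rb qc rc with a ≟ b
  ... | yes refl = a , a∈ , qa , rb
  ... | no a≢b with before-cmp a∈ b∈ a≢b
  ...   | inj₁ ab = helly-before lk us Q? R? conQ conR ab qa rb qc rc
  ...   | inj₂ ba with helly-before lk us R? Q? conR conQ ba rb qa rc qc
  ...     | x , x∈ , rx , qx = x , x∈ , qx , rx

-- From models to forbidden subgraphs

module _ {V : Set} where

  private
    variable
      a b y z : V
      t : List V

  arc-∈ : ∀ {h : V} → (a , b) ∈ zip (h ∷ t) t → a ∈ h ∷ t × b ∈ t
  arc-∈ {t = _ ∷ _} (here refl) = here refl , here refl
  arc-∈ {t = _ ∷ _} (there e) with arc-∈ e
  ... | p , q = there p , there q

  before-step : ∀ {h : V} → Unique (h ∷ t) → Before a y (h ∷ t) → (a , b) ∈ zip (h ∷ t) t → b ≢ y →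
                Before b y (h ∷ t)
  before-step {t = _ ∷ _} u (here (here refl)) (here refl) b≢y = ⊥-elim (b≢y refl)
  before-step {t = _ ∷ _} u (here (there p)) (here refl) b≢y = there (here p)
  before-step {t = _ ∷ _} (u ∷ _) (here p) (there e) _ = ⊥-elim (All.lookup u (proj₁ (arc-∈ e)) refl)
  before-step {t = _ ∷ _} (u ∷ _) (there p) (here refl) _ = ⊥-elim (All.lookup u (before-∈ˡ p) refl)
  before-step {t = _ ∷ _} (_ ∷ u) (there p) (there e) b≢y = there (before-step u p e b≢y)

  before-back : ∀ {h : V} → Unique (h ∷ t) → Before a y (h ∷ t) → (b , a) ∈ zip (h ∷ t) t →
                Before b y (h ∷ t)
  before-back {t = _ ∷ _} u p (here refl) = before-trans u (here (here refl)) p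
  before-back {t = _ ∷ _} (u ∷ _) (here p) (there e) = ⊥-elim (All.lookup u (there (proj₂ (arc-∈ e))) refl)
  before-back {t = _ ∷ _} (_ ∷ u) (there p) (there e) = there (before-back u p e)

module _ {V : Set} (_≟_ : DecidableEquality V) (T : DirectedTree V) where

  linked-adj : (P : DirectedPath T) → Linked (Adj (graph T)) (nodes P)
  linked-adj P = Linked.map (arc-adj T) (linked P)

  linked-star : ∀ {h t x} → Linked (Arc T) (h ∷ t) → x ∈ h ∷ t → Star (Arc T) h x
  linked-star _ (here refl) = ε
  linked-star (r ∷ lk) (there x∈) = r ◅ linked-star lk x∈

  before-star : ∀ {l x y} → Linked (Arc T) l → Before x y l → Star (Arc T) x y
  before-star lk (here y∈) = linked-star lk (there y∈)
  before-star (r ∷ lk) (there b) = before-star lk b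

  -- After a first arc from `x` to `z`, a directed walk leads back from `z` to `x`. Until its return
  -- it does not leave `x`, and it cannot enter `x` from `z` against the arc, so it avoids the edge.
  star-antisym : ∀ {x y} → Star (Arc T) x y → Star (Arc T) y x → x ≡ y
  star-antisym ε _ = refl
  star-antisym {x} (_◅_ {j = z} xz zy) yx = ⊥-elim (bridge _≟_ (graph T) (proj₂ (isTree T)) (arc-adj T xz)
    (Star.reverse (off-sym _≟_ (graph T)) (until (zy ◅◅ yx))))
    where
    -- The walk is stopped at its first visit to x.
    until : ∀ {w} → Star (Arc T) w x → Star (Off _≟_ (graph T) x z) w x
    until ε = ε
    until {w} (_◅_ {j = w′} ww′ s) with w ≟ x
    ... | yes refl = ε
    ... | no w≢x = (arc-adj T ww′ , λ { (inj₁ (w≡x , _)) → w≢x w≡x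
                                      ; (inj₂ (refl , refl)) → asym T xz ww′ }) ◅ until s

  -- A walk in the difference that starts before `y` stays before `y`: a step moves to a
  -- neighbouring node of `P`, so it could get past `y` only by landing on it, and `y` is deleted.
  crossing : (P Q : DirectedPath T) → ∀ {x y z} → Before x y (nodes P) → Before y z (nodes P) →
             x ∉ nodes Q → y ∈ nodes Q → z ∉ nodes Q → ¬ DifferenceConnected P Q
  crossing P Q {y = y} xy yz x∉ y∈ z∉ dc =
    stays (dc (before-∈ˡ xy) x∉ (before-∈ʳ yz) z∉) xy
    where
    stays : ∀ {a} →
            Star (λ a b → a ∉ nodes Q × b ∉ nodes Q × SymClosure (λ c d → (c , d) ∈ arcs P) a b) a _ →
            ¬ Before a y (nodes P)
    stays ε b = before-asym (distinct P) b yz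
    stays ((_ , b∉ , fwd e) ◅ w) b = stays w (before-step (distinct P) b e λ { refl → b∉ y∈ })
    stays ((_ , _ , bwd e) ◅ w) b = stays w (before-back (distinct P) b e)

module _ {n} {G : Graph (Fin n)} (M : PathDTreeModel G) where

  private
    T = tree M
    acyclic = proj₂ (isTree T)

  P∋ : Fin n → Fin (size M) → Set
  P∋ v x = x ∈ nodes (path M v)

  P∋? : ∀ v → Decidable₁ (P∋ v)
  P∋? v x = _∈?_ _≟_ x (nodes (path M v))

  path-connected : ∀ v → ConnectedIn _≟_ (graph T) (P∋ v)
  path-connected v = list-connected _≟_ (graph T) (linked-adj _≟_ T (path M v))

  meet⇒adj : ∀ {u v x} → u ≢ v → P∋ u x → P∋ v x → Adj G u v
  meet⇒adj u≢v p q = Equivalence.from (intersection M _ _ u≢v) (_ , p , q)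

  adj⇒meet : ∀ {u v} → Adj G u v → ∃[ x ] (P∋ u x × P∋ v x)
  adj⇒meet a = Equivalence.to (intersection M _ _ λ { refl → adj-irr G refl a }) a

  helly-paths : ∀ u {Q R} → Decidable₁ Q → Decidable₁ R → ConnectedIn _≟_ (graph T) Q →
                ConnectedIn _≟_ (graph T) R →
                ∀ {a b c} → P∋ u a → Q a → P∋ u b → R b → Q c → R c → ∃[ x ] (P∋ u x × Q x × R x)
  helly-paths u = helly _≟_ (graph T) acyclic (linked-adj _≟_ T (path M u)) (distinct (path M u))

  convex-paths : ∀ u v {a z b} → Before a z (nodes (path M u)) → Before z b (nodes (path M u)) → P∋ v a →
                 P∋ v b → P∋ v z
  convex-paths u v =
    convex _≟_ (graph T) acyclic (linked-adj _≟_ T (path M u)) (distinct (path M u)) (P∋? v) (path-connected v)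

  model-chordal : Chordal G
  model-chordal k (f , inj , iff) = conclude (helly-paths (f zero) (P∋? (f (suc zero)))
      (λ x → anyFin? λ j → P∋? (f (suc (suc j))) x) (path-connected _) rest-connected
      (proj₁ (proj₂ meet01)) (proj₂ (proj₂ meet01)) (proj₁ (proj₂ meet0l)) (_ , proj₂ (proj₂ meet0l))
      (proj₁ (proj₂ meet12)) (zero , proj₂ (proj₂ meet12)))
    where
    adjacent : ∀ i j → Adj (cycle (1 + k)) i j → ∃[ x ] (P∋ (f i) x × P∋ (f j) x)
    adjacent i j a = adj⇒meet (Equivalence.to (iff i j) a)

    meet01 = adjacent zero (suc zero) (inj₁ (inj₁ refl))
    meet12 = adjacent (suc zero) (suc (suc zero)) (inj₁ (inj₁ refl))
    meet0l = adjacent zero (suc (suc (fromℕ (1 + k)))) (inj₂ (inj₂ (refl , refl)))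

    rest-connected : ConnectedIn _≟_ (graph T) (λ x → ∃[ j ] P∋ (f (suc (suc j))) x)
    rest-connected = chain-connected _≟_ (graph T) (λ j → P∋ (f (suc (suc j)))) (λ j → path-connected _)
      λ i j eq → adjacent _ _ (inj₁ (inj₁ (cong (λ e → ℕ.suc (ℕ.suc e)) eq)))

    -- A common node would give a vertex of the cycle adjacent to both `zero` and `suc zero`, which
    -- exists only in a triangle.
    conclude : ¬ (∃[ x ] (P∋ (f zero) x × P∋ (f (suc zero)) x × ∃[ j ] P∋ (f (suc (suc j))) x))
    conclude (x , p , q , j , r)
      with Equivalence.from (iff zero (suc (suc j))) (meet⇒adj (λ e → case0 (inj e)) p r)
         | Equivalence.from (iff (suc zero) (suc (suc j))) (meet⇒adj (λ e → case1 (inj e)) q r)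
      where
      case0 : ∀ {j : Fin (2 + k)} → zero ≢ suc (suc j)
      case0 ()
      case1 : ∀ {j : Fin (2 + k)} → suc zero ≢ suc (suc j)
      case1 ()
    ... | inj₁ (inj₁ ()) | _
    ... | inj₁ (inj₂ ()) | _
    ... | inj₂ (inj₁ ()) | _
    ... | inj₂ (inj₂ (refl , _)) | inj₁ (inj₁ ())
    ... | inj₂ (inj₂ (refl , _)) | inj₁ (inj₂ ())
    ... | inj₂ (inj₂ (refl , _)) | inj₂ (inj₁ ())
    ... | inj₂ (inj₂ (refl , _)) | inj₂ (inj₂ ())

  path-star : ∀ u {x y} → Before x y (nodes (path M u)) → Star (Arc T) x y
  path-star u = before-star _≟_ T (linked (path M u))

  private
    -- With `x` and `y` on the same side of `c`, the nearer one would lie between two nodes of the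
    -- path of `v` or `w` that misses it, against convexity.
    two-sides : ∀ u v w {x y c} → P∋ u x → P∋ u y → P∋ u c → x ≢ y →
                P∋ v x → ¬ P∋ v y → P∋ v c → P∋ w y → ¬ P∋ w x → P∋ w c →
                (Star (Arc T) x c × Star (Arc T) c y) ⊎ (Star (Arc T) y c × Star (Arc T) c x)
    two-sides u v w {x} {y} {c} ux uy uc x≢y vx ¬vy vc wy ¬wx wc
      with before-cmp ux uc (λ { refl → ¬wx wc }) | before-cmp uy uc (λ { refl → ¬vy vc })
         | before-cmp ux uy x≢y
    ... | inj₁ xc | inj₂ cy | _ = inj₁ (path-star u xc , path-star u cy)
    ... | inj₂ cx | inj₁ yc | _ = inj₂ (path-star u yc , path-star u cx)
    ... | inj₁ xc | inj₁ yc | inj₁ xy = ⊥-elim (¬vy (convex-paths u v xy yc vx vc))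
    ... | inj₁ xc | inj₁ yc | inj₂ yx = ⊥-elim (¬wx (convex-paths u w yx xc wy wc))
    ... | inj₂ cx | inj₂ cy | inj₁ xy = ⊥-elim (¬wx (convex-paths u w cx xy wc wy))
    ... | inj₂ cx | inj₂ cy | inj₂ yx = ⊥-elim (¬vy (convex-paths u v cy yx vc vx))

  -- Node xᵢ lies on the other two triangle paths but not on the i-th one, and c lies on all three.
  -- On the path through xᵢ and xⱼ, node c is in between, so of any two of the xᵢ one is
  -- strictly above and the other strictly below c.
  model-3-SunFree : 3-SunFree G
  model-3-SunFree (f , inj , iff) = conclude
    where
    v u : Fin 3 → Fin n
    v = f ∘ inj₁
    u = f ∘ inj₂
    0F 1F 2F : Fin 3
    0F = zero
    1F = suc zero
    2F = suc (suc zero)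

    triple : ∀ {a b c} → Adj G a b → Adj G a c → Adj G b c → ∃[ x ] (P∋ a x × P∋ b x × P∋ c x)
    triple {a} {b} {c} ab ac bc with adj⇒meet ab | adj⇒meet ac | adj⇒meet bc
    ... | _ , p , q | _ , r , s | _ , t , w =
      helly-paths a (P∋? b) (P∋? c) (path-connected b) (path-connected c) p q r s t w

    vv : ∀ {i j} → i ≢ j → Adj G (v i) (v j)
    vv i≢j = Equivalence.to (iff _ _) i≢j
    uv : ∀ {i j} → i ≢ j → Adj G (u i) (v j)
    uv i≢j = Equivalence.to (iff _ _) i≢j

    -- The node is taken on the path of `u i` as well, which is disjoint from that of `v i`.
    outer : ∀ i {j k} → i ≢ j → i ≢ k → j ≢ k → ∃[ x ] (¬ P∋ (v i) x × P∋ (v j) x × P∋ (v k) x)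
    outer i i≢j i≢k j≢k with triple (uv i≢j) (uv i≢k) (vv j≢k)
    ... | x , p , q , r = x , not-i , q , r
      where
      distinct-sides : ∀ {i j : Fin 3} → inj₂ i ≢ inj₁ j
      distinct-sides ()

      not-i : ¬ P∋ (v i) x
      not-i s = Equivalence.from (iff (inj₂ i) (inj₁ i)) (meet⇒adj (λ e → distinct-sides (inj e)) p s) refl

    c = triple (vv {0F} {1F} λ ()) (vv {0F} {2F} λ ()) (vv {1F} {2F} λ ())
    x0 = outer 0F {1F} {2F} (λ ()) (λ ()) λ ()
    x1 = outer 1F {0F} {2F} (λ ()) (λ ()) λ ()
    x2 = outer 2F {0F} {1F} (λ ()) (λ ()) λ ()

    contradictory : ∀ {i x} → ¬ P∋ (v i) x → P∋ (v i) (proj₁ c) →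
                    Star (Arc T) x (proj₁ c) → ¬ Star (Arc T) (proj₁ c) x
    contradictory ¬p q s t with star-antisym _≟_ T s t
    ... | refl = ¬p q

    conclude : ⊥
    conclude with c | contradictory | x0 | x1 | x2
    ... | c , c0 , c1 , c2 | absurd | x0 , ¬p00 , p10 , p20 | x1 , ¬p11 , p01 , p21 | x2 , ¬p22 , p02 , p12
      with two-sides (v 2F) (v 1F) (v 0F) p20 p21 c2 (λ { refl → ¬p00 p01 }) p10 ¬p11 c1 p01 ¬p00 c0
         | two-sides (v 1F) (v 2F) (v 0F) p10 p12 c1 (λ { refl → ¬p00 p02 }) p20 ¬p22 c2 p02 ¬p00 c0
         | two-sides (v 0F) (v 2F) (v 1F) p01 p02 c0 (λ { refl → ¬p11 p12 }) p21 ¬p22 c2 p12 ¬p11 c1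
    -- Two sides of `c` cannot separate three nodes pairwise: each case exhibits a node both above
    -- and below `c`.
    ... | inj₁ (0c , c1′) | inj₂ (2c , c0′) | _ = absurd ¬p00 c0 0c c0′
    ... | inj₂ (1c , c0′) | inj₁ (0c , c2′) | _ = absurd ¬p00 c0 0c c0′
    ... | inj₁ (0c , c1′) | inj₁ _ | inj₁ (1c , c2′) = absurd ¬p11 c1 1c c1′
    ... | inj₁ _ | inj₁ (0c , c2′) | inj₂ (2c , c1′) = absurd ¬p22 c2 2c c2′
    ... | inj₂ _ | inj₂ (2c , c0′) | inj₁ (1c , c2′) = absurd ¬p22 c2 2c c2′
    ... | inj₂ (1c , c0′) | inj₂ _ | inj₂ (2c , c1′) = absurd ¬p11 c1 1c c1′

  -- The leaves meet the path of the centre in three distinct nodes. Deleting the path of the leaf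
  -- that owns the middle one separates the other two, so it crosses the path of the centre.
  model-clawFree : IsNC M → ClawFree G
  model-clawFree nc (f , inj , iff) = conclude (meets zero) (meets (suc zero)) (meets (suc (suc zero)))
    where
    meets : ∀ i → ∃[ x ] (P∋ (f zero) x × P∋ (f (suc i)) x)
    meets i = adj⇒meet (Equivalence.to (iff zero (suc i)) tt)

    disjoint : ∀ i j {x} → i ≢ j → P∋ (f (suc i)) x → ¬ P∋ (f (suc j)) x
    disjoint i j i≢j p q = Equivalence.from (iff (suc i) (suc j)) (meet⇒adj (λ e → i≢j (suc-inj (inj e))) p q)
      where
      suc-inj : suc i ≡ suc j → i ≡ j
      suc-inj refl = refl

    middle : ∀ i j k {x y z} → i ≢ j → k ≢ j → Before x y (nodes (path M (f zero))) →
             Before y z (nodes (path M (f zero))) →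
             P∋ (f (suc i)) x → P∋ (f (suc j)) y → ¬ P∋ (f (suc k)) z
    middle i j k i≢j k≢j xy yz px py pz =
      crossing _≟_ T (path M (f zero)) (path M (f (suc j))) xy yz (disjoint i j i≢j px) py (disjoint k j k≢j pz)
        (proj₁ (nc (f zero) (f (suc j)) λ e → different (inj e)))
      where
      different : zero ≢ suc j
      different ()

    sorted : ∀ i j k {x y z} → i ≢ j → i ≢ k → j ≢ k → P∋ (f zero) x → P∋ (f zero) y → P∋ (f zero) z →
             P∋ (f (suc i)) x → P∋ (f (suc j)) y → ¬ P∋ (f (suc k)) z
    sorted i j k {x} {y} {z} i≢j i≢k j≢k cx cy cz px py pz
      with before-cmp cx cy (λ { refl → disjoint i j i≢j px py })
         | before-cmp cx cz (λ { refl → disjoint i k i≢k px pz })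
         | before-cmp cy cz (λ { refl → disjoint j k j≢k py pz })
    ... | inj₁ xy | _ | inj₁ yz = middle i j k i≢j (j≢k ∘ sym) xy yz px py pz
    ... | inj₁ xy | inj₁ xz | inj₂ zy = middle i k j i≢k j≢k xz zy px pz py
    ... | inj₁ xy | inj₂ zx | inj₂ zy = middle k i j (i≢k ∘ sym) (i≢j ∘ sym) zx xy pz px py
    ... | inj₂ yx | inj₁ xz | _ = middle j i k (i≢j ∘ sym) (i≢k ∘ sym) yx xz py px pz
    ... | inj₂ yx | inj₂ zx | inj₁ yz = middle j k i j≢k i≢k yz zx py pz px
    ... | inj₂ yx | inj₂ zx | inj₂ zy = middle k j i (j≢k ∘ sym) i≢j zy yx pz py px

    conclude : ∃[ x ] (P∋ (f zero) x × P∋ (f (suc zero)) x) →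
               ∃[ x ] (P∋ (f zero) x × P∋ (f (suc (suc zero))) x) →
               ¬ (∃[ x ] (P∋ (f zero) x × P∋ (f (suc (suc (suc zero)))) x))
    conclude (_ , cx , px) (_ , cy , py) (_ , cz , pz) =
      sorted zero (suc zero) (suc (suc zero)) (λ ()) (λ ()) (λ ()) cx cy cz px py pz

-- Holes from induced paths

module _ {V : Set} (G : Graph V) where

  -- As its ends are distinct and non-adjacent, the path has at least two edges; closing it through
  -- `w` therefore gives length at least four.
  closed-path : ∀ {w a b l} → InducedPath (Adj G) a b l → a ≢ b → ¬ Adj G a b → Adj G w a → Adj G w b →
                (∀ {x} → x ∈ l → x ≢ b → w ≢ x × ¬ Adj G w x) → ∃[ k ] (cycle (1 + k) ⊆ⁱ G)
  closed-path [] a≢b _ _ _ _ = ⊥-elim (a≢b refl)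
  closed-path (cons ab _ _ []) _ ¬ab _ _ _ = ⊥-elim (¬ab ab)
  closed-path {w} {a} {b} {l@(_ ∷ _ ∷ l′)} p@(cons _ _ _ (cons _ _ _ _)) a≢b ¬ab wa wb off =
    length l′ , f , injective , λ i j → mk⇔ (to i j) (from i j)
    where
    k = length l′

    f : Fin (4 + k) → V
    f = lookup (w ∷ a ∷ l)

    last : f (fromℕ (3 + k)) ≡ b
    last = path-last p

    is-last : ∀ i → f (suc i) ≡ b → suc i ≡ fromℕ (3 + k)
    is-last i e = cong suc (path-injective p i _ (trans e (sym last)))

    w≢f : ∀ i → w ≢ f (suc i)
    w≢f zero refl = adj-irr G refl wa
    w≢f (suc i) refl = proj₁ (off (∈-lookup {xs = l} i) λ { refl → adj-irr G refl wb }) refl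

    injective : ∀ {i j} → f i ≡ f j → i ≡ j
    injective {zero} {zero} _ = refl
    injective {zero} {suc j} e = ⊥-elim (w≢f j e)
    injective {suc i} {zero} e = ⊥-elim (w≢f i (sym e))
    injective {suc i} {suc j} e = cong suc (path-injective p i j e)

    next : ∀ i j → Next (1 + k) i j → Adj G (f i) (f j)
    next zero (suc zero) (inj₁ _) = wa
    next (suc i) (suc j) (inj₁ e) = path-step p i j (ℕ.suc-injective e)
    next i j (inj₂ (refl , refl)) = subst (λ z → Adj G z w) (sym last) (adj-sym G wb)

    to : ∀ i j → Adj (cycle (1 + k)) i j → Adj G (f i) (f j)
    to i j (inj₁ e) = next i j e
    to i j (inj₂ e) = adj-sym G (next j i e)

    from-w : ∀ j → Adj G w (f (suc j)) → Next (1 + k) zero (suc j) ⊎ Next (1 + k) (suc j) zero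
    from-w zero _ = inj₁ (inj₁ refl)
    from-w (suc j) r with toℕ j ℕ.≟ 1 + k
    ... | yes e = inj₂ (inj₂ (toℕ-injective (cong (2 +_) (trans e (sym (toℕ-fromℕ _)))) , refl))
    ... | no ¬e = ⊥-elim (proj₂ (off (∈-lookup {xs = l} j) λ e →
            ¬e (ℕ.suc-injective (ℕ.suc-injective (trans (cong toℕ (is-last (suc j) e)) (toℕ-fromℕ _))))) r)

    from-path : ∀ i j → toℕ i < toℕ j → Adj G (f (suc i)) (f (suc j)) → toℕ (suc j) ≡ ℕ.suc (toℕ (suc i))
    from-path i j i<j r with ℕ.m≤n⇒m<n∨m≡n i<j
    ... | inj₁ far = ⊥-elim (path-far p i j far r)
    ... | inj₂ e = cong ℕ.suc (sym e)

    from : ∀ i j → Adj G (f i) (f j) → Adj (cycle (1 + k)) i j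
    from zero zero r = ⊥-elim (adj-irr G refl r)
    from zero (suc j) r = from-w j r
    from (suc i) zero r with from-w i (adj-sym G r)
    ... | inj₁ e = inj₂ e
    ... | inj₂ e = inj₁ e
    from (suc i) (suc j) r with ℕ.<-cmp (toℕ i) (toℕ j)
    ... | tri< i<j _ _ = inj₁ (inj₁ (from-path i j i<j r))
    ... | tri≈ _ i≡j _ = ⊥-elim (adj-irr G (cong (f ∘ suc) (toℕ-injective i≡j)) r)
    ... | tri> _ _ j<i = inj₂ (inj₁ (from-path j i j<i (adj-sym G r)))

-- Perfect elimination orders

module _ {n : ℕ} (G : Graph (Fin n)) where

  Simplicial : List (Fin n) → Fin n → Set
  Simplicial S w = ∀ {a b} → a ∈ S → b ∈ S → Adj G w a → Adj G w b → a ≢ b → Adj G a b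

  data EliminationOrder (r : Fin n) : List (Fin n) → Set where
    last : EliminationOrder r (r ∷ [])
    _∷_  : ∀ {s L} → (s ∉ L × Simplicial L s) → EliminationOrder r L → EliminationOrder r (s ∷ L)

  Far : List (Fin n) → Fin n → Set
  Far U w = ∀ {u} → u ∈ U → u ≢ w × ¬ Adj G u w

  module _ (chordal : Chordal G) where

    -- Otherwise an induced path from `a` to `b` with its interior in `U` would be closed by `w` to
    -- a hole.
    separator-clique : ∀ {U w a b} → ConnectedIn _≟_ G (_∈ U) → Far U w → Adj G w a → Adj G w b →
                       (∃[ u ] (u ∈ U × Adj G u a)) → (∃[ u ] (u ∈ U × Adj G u b)) → a ≢ b → Adj G a b
    separator-clique {U} {w} {a} {b} con far wa wb (u , u∈ , ua) (u′ , u′∈ , u′b) a≢b =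
      decidable-stable (adj? G a b) λ ¬ab → let
        l , p , in-U = inducedPath _≟_ (adj? G) walk
        k , hole = closed-path G p a≢b ¬ab wa wb λ x∈ x≢b → apart (All.lookup in-U x∈) x≢b
        in chordal k hole
      where
      walk : Star (λ x y → Adj G x y × (y ∈ U ⊎ y ≡ b)) a b
      walk = (adj-sym G ua , inj₁ u∈) 
             ◅ Star.map (λ (r , _ , y∈) → r , inj₁ y∈) (con u∈ u′∈) ◅◅ ((u′b , inj₂ refl) ◅ ε)

      apart : ∀ {x} → x ∈ U ⊎ x ≡ b → x ≢ b → w ≢ x × ¬ Adj G w x
      apart (inj₁ x∈) _ = proj₁ (far x∈) ∘ sym , proj₂ (far x∈) ∘ adj-sym G
      apart (inj₂ x≡b) x≢b = ⊥-elim (x≢b x≡b)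

    grow : ∀ {U x} → ConnectedIn _≟_ G (_∈ U) → (∃[ u ] (u ∈ U × Adj G u x)) → ConnectedIn _≟_ G (_∈ x ∷ U)
    grow {U} {x} con (u , u∈ , ux) p q = to p ◅◅ Star.reverse (λ (r , a , b) → adj-sym G r , b , a) (to q)
      where
      to : ∀ {y} → y ∈ x ∷ U → Star (λ a b → Adj G a b × a ∈ x ∷ U × b ∈ x ∷ U) y u
      to (here refl) = (adj-sym G ux , here refl , there u∈) ◅ ε
      to (there y∈) = Star.map (λ (r , a , b) → r , there a , there b) (con y∈ u∈)

    singleton-connected : ∀ v → ConnectedIn _≟_ G (_∈ v ∷ [])
    singleton-connected v (here refl) (here refl) = ε

    Mixed : List (Fin n) → Fin n → Set
    Mixed W x = x ∉ W × Any (Adj G x) W × Any (λ w → ¬ Adj G x w) W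

    mixed? : ∀ W → Decidable₁ (Mixed W)
    mixed? W x = ¬? (_∈?_ _≟_ x W) ×-dec (any? (adj? G x) W ×-dec any? (λ w → ¬? (adj? G x w)) W)

    nonAdjacent? : ∀ v → Decidable₁ (λ w → v ≢ w × ¬ Adj G v w)
    nonAdjacent? v w = ¬? (v ≟ w) ×-dec ¬? (adj? G v w)

    -- This is the domination hypothesis of `simplicial-far` in its initial state, where the
    -- connected set is the singleton of `v`.
    nonAdjacent-dominated : ∀ v {S s} → s ∈ S → s ∉ filter (nonAdjacent? v) S →
                            s ∈ v ∷ [] ⊎ (∃[ u ] (u ∈ v ∷ [] × Adj G u s))
    nonAdjacent-dominated v {S} {s} s∈ s∉ with v ≟ s | adj? G v s
    ... | yes refl | _ = inj₁ (here refl)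
    ... | no _ | yes vs = inj₂ (v , here refl , vs)
    ... | no v≢s | no ¬vs = ⊥-elim (s∉ (∈-filter⁺ (nonAdjacent? v) s∈ (v≢s , ¬vs)))

    -- A connected set U splits the other vertices of S into its neighbours and the set W of vertices
    -- far from U. A neighbour of U that distinguishes vertices of W is added to U, which shrinks W.
    -- When there is none, the neighbours of U that see W form a clique complete to W, so that
    -- a simplicial vertex of W is simplicial in S.
    simplicial-far : ∀ m {S U W w₀} → length W < m → w₀ ∈ W → (∀ {w} → w ∈ W → w ∈ S) →
                     (∀ {w} → w ∈ W → Far U w) →
                     (∀ {s} → s ∈ S → s ∉ W → s ∈ U ⊎ (∃[ u ] (u ∈ U × Adj G u s))) →
                     ConnectedIn _≟_ G (_∈ U) →
                     ∃[ w ] (w ∈ W × Simplicial S w)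
    simplicial-far (ℕ.suc m) {S} {U} {W} {w₀} |W|<m w₀∈ W⊆S far dominated con with any? (mixed? W) S
    ... | yes mixed with find mixed
    ... | x , x∈S , x∉W , sees , misses with find misses
    ... | w₁ , w₁∈ , ¬xw₁ =
      let w , w∈ , simp = simplicial-far m {S} {x ∷ U}
            (ℕ.≤-trans (filter-notAll far? W (Any.map (λ r ¬r → ¬r r) sees)) (ℕ.≤-pred |W|<m))
            (∈-filter⁺ far? w₁∈ ¬xw₁) (W⊆S ∘ W′⊆W) far′ dominated′ (grow con (neighbour x∈S x∉W))
      in w , W′⊆W w∈ , simp
      where
      far? : Decidable₁ (λ w → ¬ Adj G x w)
      far? w = ¬? (adj? G x w)

      W′⊆W : ∀ {w} → w ∈ filter far? W → w ∈ W
      W′⊆W w∈ = proj₁ (∈-filter⁻ far? w∈)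

      neighbour : ∀ {s} → s ∈ S → s ∉ W → ∃[ u ] (u ∈ U × Adj G u x)
      neighbour _ _ with dominated x∈S x∉W | find sees
      ... | inj₂ d | _ = d
      ... | inj₁ x∈U | w , w∈ , xw = ⊥-elim (proj₂ (far w∈ x∈U) xw)

      far′ : ∀ {w} → w ∈ filter far? W → Far (x ∷ U) w
      far′ w∈ (here refl) = (λ { refl → x∉W (W′⊆W w∈) }) , proj₂ (∈-filter⁻ far? {xs = W} w∈)
      far′ w∈ (there u∈) = far (W′⊆W w∈) u∈

      dominated′ : ∀ {s} → s ∈ S → s ∉ filter far? W → s ∈ x ∷ U ⊎ (∃[ u ] (u ∈ x ∷ U × Adj G u s))
      dominated′ {s} s∈ s∉ with _∈?_ _≟_ s W
      ... | yes s∈W = inj₂ (x , here refl , decidable-stable (adj? G x s) λ ¬xs → s∉ (∈-filter⁺ far? s∈W ¬xs))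
      ... | no s∉W with dominated s∈ s∉W
      ...   | inj₁ s∈U = inj₁ (there s∈U)
      ...   | inj₂ (u , u∈ , us) = inj₂ (u , there u∈ , us)
    simplicial-far (ℕ.suc m) {S} {U} {W} {w₀} |W|<m w₀∈ W⊆S far dominated con | no ¬mixed =
      let w , w∈ , simp = inside in w , w∈ , λ {a} {b} → outside w∈ simp
      where
      inside : ∃[ w ] (w ∈ W × Simplicial W w)
      -- In a clique every vertex is simplicial. Otherwise the recursion takes `W` as the ambient
      -- set and one vertex `v` of a non-adjacent pair as the new connected set; the other vertex
      -- keeps the new far set non-empty.
      inside with any? (λ v → any? (nonAdjacent? v) W) W
      ... | no clique = w₀ , w₀∈ , λ {a} {b} a∈ b∈ _ _ a≢b →
        decidable-stable (adj? G a b) λ ¬ab → clique (lose a∈ (lose b∈ (a≢b , ¬ab)))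
      ... | yes nonadjacent with find nonadjacent
      ... | v , v∈ , miss with find miss
      ... | v′ , v′∈ , ¬vv′ =
        let w , w∈ , simp = simplicial-far m {W} {v ∷ []}
              (ℕ.≤-trans (filter-notAll far? W (lose v∈ λ p → proj₁ p refl)) (ℕ.≤-pred |W|<m))
              (∈-filter⁺ far? v′∈ ¬vv′) (λ p → proj₁ (∈-filter⁻ far? p))
              (λ { p (here refl) → proj₂ (∈-filter⁻ far? {xs = W} p) })
              (nonAdjacent-dominated v) (singleton-connected v)
        in w , proj₁ (∈-filter⁻ far? w∈) , simp
        where far? = nonAdjacent? v

      complete : ∀ {x w w′} → x ∈ S → x ∉ W → w ∈ W → w′ ∈ W → Adj G x w → Adj G x w′
      complete {x} {w′ = w′} x∈ x∉ w∈ w′∈ xw =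
        decidable-stable (adj? G x w′) λ ¬xw′ → ¬mixed (lose x∈ (x∉ , lose w∈ xw , lose w′∈ ¬xw′))

      neighbour : ∀ {w x} → w ∈ W → x ∈ S → x ∉ W → Adj G w x → ∃[ u ] (u ∈ U × Adj G u x)
      neighbour w∈ x∈ x∉ wx with dominated x∈ x∉
      ... | inj₁ x∈U = ⊥-elim (proj₂ (far w∈ x∈U) (adj-sym G wx))
      ... | inj₂ d = d

      outside : ∀ {w} → w ∈ W → Simplicial W w → Simplicial S w
      outside w∈ simp {a} {b} a∈ b∈ wa wb a≢b with _∈?_ _≟_ a W | _∈?_ _≟_ b W
      ... | yes a∈W | yes b∈W = simp a∈W b∈W wa wb a≢b
      ... | yes a∈W | no b∉W = adj-sym G (complete b∈ b∉W w∈ a∈W (adj-sym G wb))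
      ... | no a∉W | yes b∈W = complete a∈ a∉W w∈ b∈W (adj-sym G wa)
      ... | no a∉W | no b∉W =
        separator-clique con (far w∈) wa wb (neighbour w∈ a∈ a∉W wa) (neighbour w∈ b∈ b∉W wb) a≢b

    simplicial-other : ∀ m {S} → length S < m → ∀ {r} → r ∈ S →
                       (∀ {s} → s ∈ S → s ≡ r) ⊎ (∃[ s ] (s ∈ S × s ≢ r × Simplicial S s))
    simplicial-other (ℕ.suc m) {S} |S|<m {r} r∈ with any? (λ s → ¬? (s ≟ r)) S
    ... | no trivial = inj₁ λ {s} s∈ → decidable-stable (s ≟ r) λ s≢r → trivial (lose s∈ s≢r)
    ... | yes nontrivial with any? (nonAdjacent? r) S
    ... | yes misses with find misses
    ... | w , w∈ , rw =
      let s , s∈ , simp = simplicial-far (ℕ.suc (length (filter far? S))) {S} {r ∷ []} ℕ.≤-refl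
            (∈-filter⁺ far? w∈ rw)
            (λ p → proj₁ (∈-filter⁻ far? p)) (λ { p (here refl) → proj₂ (∈-filter⁻ far? {xs = S} p) })
            (nonAdjacent-dominated r) (singleton-connected r)
          s∈S , r≢s , _ = ∈-filter⁻ far? {xs = S} s∈
      in inj₂ (s , s∈S , r≢s ∘ sym , λ {a} {b} → simp)
      where far? = nonAdjacent? r
    simplicial-other (ℕ.suc m) {S} |S|<m {r} r∈ | yes nontrivial | no universal with find nontrivial
    ... | r′ , r′∈ , r′≢r = inj₂ (answer (simplicial-other m
            (ℕ.≤-trans (filter-notAll other? S (lose r∈ λ ¬e → ¬e refl)) (ℕ.≤-pred |S|<m))
            (∈-filter⁺ other? r′∈ r′≢r)))
      where
      other? : Decidable₁ (λ s → s ≢ r)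
      other? s = ¬? (s ≟ r)
      S′ = filter other? S

      sees : ∀ {s} → s ∈ S → s ≢ r → Adj G r s
      sees {s} s∈ s≢r = decidable-stable (adj? G r s) λ ¬rs → universal (lose s∈ (s≢r ∘ sym , ¬rs))

      add-universal : ∀ {s} → Simplicial S′ s → Simplicial S s
      add-universal simp {a} {b} a∈ b∈ sa sb a≢b with a ≟ r | b ≟ r
      ... | yes refl | yes refl = ⊥-elim (a≢b refl)
      ... | yes refl | no b≢r = sees b∈ b≢r
      ... | no a≢r | yes refl = adj-sym G (sees a∈ a≢r)
      ... | no a≢r | no b≢r = simp (∈-filter⁺ other? a∈ a≢r) (∈-filter⁺ other? b∈ b≢r) sa sb a≢b

      answer : (∀ {s} → s ∈ S′ → s ≡ r′) ⊎ (∃[ s ] (s ∈ S′ × s ≢ r′ × Simplicial S′ s)) →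
               ∃[ s ] (s ∈ S × s ≢ r × Simplicial S s)
      answer (inj₁ trivial) = r′ , r′∈ , r′≢r , λ {a} {b} → add-universal λ {a} {b} a∈ b∈ _ _ a≢b →
        ⊥-elim (a≢b (trans (trivial a∈) (sym (trivial b∈))))
      answer (inj₂ (s , s∈ , _ , simp)) with ∈-filter⁻ other? {xs = S} s∈
      ... | s∈S , s≢r = s , s∈S , s≢r , λ {a} {b} → add-universal simp

    elimination-order : ∀ m {S} → length S < m → ∀ {r} → r ∈ S →
                        ∃[ L ] (EliminationOrder r L × (∀ {v} → v ∈ S → v ∈ L) × (∀ {v} → v ∈ L → v ∈ S))
    elimination-order (ℕ.suc m) {S} |S|<m {r} r∈ with simplicial-other (ℕ.suc m) |S|<m r∈
    ... | inj₁ trivial = r ∷ [] , last , (λ v∈ → here (trivial v∈)) , λ { (here refl) → r∈ }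
    ... | inj₂ (s , s∈ , s≢r , simp) with elimination-order m
            (ℕ.≤-trans (filter-notAll (λ v → ¬? (v ≟ s)) S (lose s∈ λ ¬e → ¬e refl)) (ℕ.≤-pred |S|<m))
            (∈-filter⁺ (λ v → ¬? (v ≟ s)) r∈ (s≢r ∘ sym))
    ... | L , order , to , from = s ∷ L , (s∉L , simp′) ∷ order , into , onto
      where
      other? : Decidable₁ (λ v → v ≢ s)
      other? v = ¬? (v ≟ s)

      s∉L : s ∉ L
      s∉L s∈L = proj₂ (∈-filter⁻ other? {xs = S} (from s∈L)) refl

      simp′ : Simplicial L s
      simp′ a∈ b∈ = simp (proj₁ (∈-filter⁻ other? (from a∈))) (proj₁ (∈-filter⁻ other? (from b∈)))

      into : ∀ {v} → v ∈ S → v ∈ s ∷ L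
      into {v} v∈ with v ≟ s
      ... | yes refl = here refl
      ... | no v≢s = there (to (∈-filter⁺ other? v∈ v≢s))

      onto : ∀ {v} → v ∈ s ∷ L → v ∈ S
      onto (here refl) = s∈
      onto (there v∈) = proj₁ (∈-filter⁻ other? (from v∈))

    -- `simplicial-other` serves twice: avoiding an arbitrary `v₀` it finds `r`, and avoiding `r` it
    -- then supplies every vertex to be eliminated before `r`.
    elimination-from-simplicial : Fin n →
                                  ∃[ r ] (Simplicial (allFin n) r × ∃[ L ] (EliminationOrder r L × (∀ v → v ∈ L)))
    elimination-from-simplicial v₀ =
      let r , simp = simplicial-vertex
          L , order , into , _ = elimination-order (ℕ.suc (length (allFin n))) ℕ.≤-refl (∈-allFin r)
      in r , (λ {a} {b} → simp) , L , order , λ v → into (∈-allFin v)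
      where
      simplicial-vertex : ∃[ r ] Simplicial (allFin n) r
      simplicial-vertex with simplicial-other (ℕ.suc (length (allFin n))) ℕ.≤-refl (∈-allFin v₀)
      ... | inj₁ trivial = v₀ , λ a∈ b∈ _ _ a≢b → ⊥-elim (a≢b (trans (trivial a∈) (sym (trivial b∈))))
      ... | inj₂ (r , _ , _ , simp) = r , λ {a} {b} → simp

-- Rooted trees

argmin : ∀ {m} (f : Fin (ℕ.suc m) → ℕ) → ∃[ i ] (∀ j → f i ≤ f j)
argmin {ℕ.zero} f = zero , λ { zero → ℕ.≤-refl }
argmin {ℕ.suc m} f with argmin (f ∘ suc)
... | i , least with ℕ.≤-total (f zero) (f (suc i))
...   | inj₁ le = zero , λ { zero → ℕ.≤-refl ; (suc j) → ℕ.≤-trans le (least j) }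
...   | inj₂ ge = suc i , λ { zero → ge ; (suc j) → least j }

cycle-neighbours : ∀ k (i : Fin (3 + k)) →
                   ∃[ j ] ∃[ j′ ] (j ≢ j′ × Adj (cycle k) j i × Adj (cycle k) j′ i)
cycle-neighbours k zero = suc zero , fromℕ (2 + k) , (λ ()) , inj₂ (inj₁ refl) , inj₁ (inj₂ (refl , refl))
-- Equality holds exactly if `suc i` is the last vertex, whose index is `2 + k`; its successor is
-- then `zero`.
cycle-neighbours k (suc i) with toℕ i ℕ.≟ 1 + k
... | yes e = inject₁ i , zero , previous≢zero , inj₁ (inj₁ (cong ℕ.suc (sym (toℕ-inject₁ i))))
            , inj₂ (inj₂ (toℕ-injective (cong ℕ.suc (trans e (sym (toℕ-fromℕ _)))) , refl))
  where
  previous≢zero : inject₁ i ≢ zero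
  previous≢zero p = ℕ.1+n≢0 (trans (sym e) (trans (sym (toℕ-inject₁ i)) (cong toℕ p)))
... | no ¬e = inject₁ i , suc (suc i⁻) , previous≢next
            , inj₁ (inj₁ (cong ℕ.suc (sym (toℕ-inject₁ i)))) , inj₂ (inj₁ next)
  where
  i⁻ = lower₁ i (¬e ∘ sym)

  next : 2 + toℕ i⁻ ≡ 2 + toℕ i
  next = cong (2 +_) (toℕ-lower₁ i (¬e ∘ sym))

  previous≢next : inject₁ i ≢ suc (suc i⁻)
  previous≢next p = ℕ.m≢1+n+m (toℕ i) {1} (trans (sym (toℕ-inject₁ i)) (trans (cong toℕ p) next))

-- Rooted trees grown by attaching leaves: the newest node is zero, so arcs decrease the index
-- and the root is the last node.
data Growth : ℕ → Set where
  root : Growth 1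
  leaf : ∀ {m} → Fin m → Growth m → Growth (ℕ.suc m)

top : ∀ {m} → Growth m → Fin m
top root = zero
top (leaf _ T) = suc (top T)

ArcOf : ∀ {m} → Growth m → Rel (Fin m) 0ℓ
ArcOf root _ _ = ⊥
ArcOf (leaf p T) (suc x) (suc y) = ArcOf T x y
ArcOf (leaf p T) (suc x) zero = x ≡ p
ArcOf (leaf p T) zero _ = ⊥

arcOf? : ∀ {m} (T : Growth m) → Decidable (ArcOf T)
arcOf? root _ _ = no λ ()
arcOf? (leaf p T) (suc x) (suc y) = arcOf? T x y
arcOf? (leaf p T) (suc x) zero = x ≟ p
arcOf? (leaf p T) zero _ = no λ ()

arc-< : ∀ {m} (T : Growth m) {x y} → ArcOf T x y → toℕ y < toℕ x
arc-< (leaf p T) {suc x} {zero} _ = s≤s z≤n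
arc-< (leaf p T) {suc x} {suc y} a = s≤s (arc-< T a)

parent-unique : ∀ {m} (T : Growth m) {x x′ y} → ArcOf T x y → ArcOf T x′ y → x ≡ x′
parent-unique (leaf p T) {suc x} {suc x′} {zero} refl refl = refl
parent-unique (leaf p T) {suc x} {suc x′} {suc y} a a′ = cong suc (parent-unique T a a′)

parent : ∀ {m} (T : Growth m) x → x ≡ top T ⊎ (∃[ y ] ArcOf T y x)
parent root zero = inj₁ refl
parent (leaf p T) zero = inj₂ (suc p , refl)
parent (leaf p T) (suc x) with parent T x
... | inj₁ refl = inj₁ refl
... | inj₂ (y , a) = inj₂ (suc y , a)

top-source : ∀ {m} (T : Growth m) y → ¬ ArcOf T y (top T)
top-source (leaf p T) (suc y) a = top-source T y a

top-reaches : ∀ {m} (T : Growth m) x → Star (ArcOf T) (top T) x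
top-reaches root zero = ε
top-reaches (leaf p T) zero = Star.gmap suc id (top-reaches T p) ◅◅ (refl ◅ ε)
top-reaches (leaf p T) (suc x) = Star.gmap suc id (top-reaches T x)

growth-graph : ∀ {m} → Growth m → Graph (Fin m)
growth-graph T = record
  { Adj     = λ x y → ArcOf T x y ⊎ ArcOf T y x
  ; adj?    = λ x y → arcOf? T x y ⊎-dec arcOf? T y x
  ; adj-sym = swap
  ; adj-irr = λ { refl (inj₁ a) → ℕ.<-irrefl refl (arc-< T a) ; refl (inj₂ a) → ℕ.<-irrefl refl (arc-< T a) }
  }

growth-connected : ∀ {m} (T : Growth m) → Connected (growth-graph T)
growth-connected T = top T , λ x y →
  Star.reverse swap (Star.map inj₁ (top-reaches T x)) ◅◅ Star.map inj₁ (top-reaches T y)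

-- The node of least index on a cycle would have two parents.
growth-acyclic : ∀ {m} (T : Growth m) → Acyclic (growth-graph T)
growth-acyclic T k (f , inj , hom) =
  let i , least = argmin (toℕ ∘ f)
      j , j′ , j≢j′ , a , a′ = cycle-neighbours k i
      down : ∀ {j} → Adj (cycle k) j i → ArcOf T (f j) (f i)
      down {j} e = descend (least j) (hom j i e)
  in j≢j′ (inj (parent-unique T (down a) (down a′)))
  where
  descend : ∀ {x y} → toℕ y ≤ toℕ x → ArcOf T x y ⊎ ArcOf T y x → ArcOf T x y
  descend _ (inj₁ a) = a
  descend y≤x (inj₂ a) = ⊥-elim (ℕ.<⇒≱ (arc-< T a) y≤x)

growth-tree : ∀ {m} → Growth m → DirectedTree (Fin m)
growth-tree T = record
  { graph = growth-graph T
  ; isTree = growth-connected T , growth-acyclic T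
  ; Arc = ArcOf T
  ; arc-adj = inj₁
  ; orient = id
  ; asym = λ a b → ℕ.<-asym (arc-< T a) (arc-< T b)
  }

growth-rooted : ∀ {m} (T : Growth m) → IsRooted (growth-tree T)
growth-rooted T = record
  { root = top T
  ; source = top-source T
  ; unique = λ x source → only x source (parent T x)
  ; away = top-reaches T
  }
  where
  only : ∀ x → (∀ y → ¬ ArcOf T y x) → x ≡ top T ⊎ (∃[ y ] ArcOf T y x) → x ≡ top T
  only x _ (inj₁ e) = e
  only x source (inj₂ (y , a)) = ⊥-elim (source y a)

-- Connectedness of a possibly empty set of nodes, put recursively along the growth: the newest leaf
-- is linked to the older nodes only through `p`.
Subtree : ∀ {m} → Growth m → (Fin m → Set) → Set
Subtree root S = ⊤
Subtree (leaf p T) S = Subtree T (S ∘ suc) × (S zero → S (suc p) ⊎ (∀ x → ¬ S (suc x)))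

subtree-connected : ∀ {m} (T : Growth m) {S} → Subtree T S → ConnectedIn _≟_ (growth-graph T) S
subtree-connected root _ {zero} {zero} _ _ = ε
subtree-connected (leaf p T) {S} (sub , attached) = connect
  where
  lift : ∀ {x y} → S (suc x) → S (suc y) →
         Star (λ a b → Adj (growth-graph (leaf p T)) a b × S a × S b) (suc x) (suc y)
  lift sx sy = Star.gmap suc id (subtree-connected T sub sx sy)

  connect : ConnectedIn _≟_ (growth-graph (leaf p T)) S
  connect {zero} {zero} _ _ = ε
  connect {suc x} {suc y} sx sy = lift sx sy
  connect {zero} {suc y} s0 sy with attached s0
  ... | inj₁ sp = (inj₂ refl , s0 , sp) ◅ lift sp sy
  ... | inj₂ none = ⊥-elim (none y sy)
  connect {suc x} {zero} sx s0 with attached s0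
  ... | inj₁ sp = lift sx sp ◅◅ ((inj₁ refl , sp , s0) ◅ ε)
  ... | inj₂ none = ⊥-elim (none x sx)

Unbranched : ∀ {m} → Growth m → (Fin m → Set) → Set
Unbranched T S = ∀ {t a b} → ArcOf T t a → ArcOf T t b → S a → S b → a ≡ b

attach-leaf : ∀ {m} (p : Fin m) (T : Growth m) l → Linked (ArcOf T) l → p ∈ l →
              (∀ {a} → a ∈ l → ¬ ArcOf T p a) →
              Linked (ArcOf (leaf p T)) (map suc l ++ zero ∷ [])
attach-leaf p T (h ∷ []) [-] (here refl) _ = refl ∷ [-]
attach-leaf p T (h ∷ h′ ∷ l) (a ∷ lk) (here refl) childless = ⊥-elim (childless (there (here refl)) a)
attach-leaf p T (h ∷ h′ ∷ l) (a ∷ lk) (there p∈) childless = a ∷ attach-leaf p T (h′ ∷ l) lk p∈ (childless ∘ there)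

-- A new leaf in `S` can be appended at the end of the list: `p` is the last entry, since an entry
-- following `p` would be a second child of `p` in `S`.
descending-list : ∀ {m} (T : Growth m) {S : Fin m → Set} → Decidable₁ S → Subtree T S → Unbranched T S →
                  ∃[ l ] (Linked (ArcOf T) l × (∀ {x} → S x → x ∈ l) × (∀ {x} → x ∈ l → S x))
descending-list root S? _ _ with S? zero
... | yes s = zero ∷ [] , [-] , (λ { {zero} _ → here refl }) , λ { (here refl) → s }
... | no ¬s = [] , [] , (λ { {zero} s → ⊥-elim (¬s s) }) , λ ()
descending-list (leaf p T) {S} S? (sub , attached) unbranched
  with descending-list T (S? ∘ suc) sub (λ {t} {a} {b} ta tb sa sb →
         suc-injective (unbranched {suc t} {suc a} {suc b} ta tb sa sb))
     | S? zero
... | l , lk , into , onto | no ¬s = map suc l , Linked.map⁺ lk , into′ , onto′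
  where
  into′ : ∀ {x} → S x → x ∈ map suc l
  into′ {zero} s = ⊥-elim (¬s s)
  into′ {suc x} s = ∈-map⁺ suc (into s)

  onto′ : ∀ {x} → x ∈ map suc l → S x
  onto′ x∈ with ∈-map⁻ suc x∈
  ... | _ , y∈ , refl = onto y∈
... | l , lk , into , onto | yes s with attached s
...   | inj₂ none = zero ∷ [] , [-] , into′ , λ { (here refl) → s }
  where
  into′ : ∀ {x} → S x → x ∈ zero ∷ []
  into′ {zero} _ = here refl
  into′ {suc x} sx = ⊥-elim (none x sx)
...   | inj₁ sp = map suc l ++ zero ∷ [] , attach-leaf p T l lk (into sp) childless , into′ , onto′
  where
  childless : ∀ {a} → a ∈ l → ¬ ArcOf T p a
  childless {a} a∈ pa with unbranched {suc p} {suc a} {zero} pa refl (onto a∈) s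
  ... | ()

  into′ : ∀ {x} → S x → x ∈ map suc l ++ zero ∷ []
  into′ {zero} _ = ∈-++⁺ʳ (map suc l) (here refl)
  into′ {suc x} sx = ∈-++⁺ˡ (∈-map⁺ suc (into sx))

  onto′ : ∀ {x} → x ∈ map suc l ++ zero ∷ [] → S x
  onto′ x∈ with ∈-++⁻ (map suc l) x∈
  ... | inj₂ (here refl) = s
  ... | inj₁ x∈′ with ∈-map⁻ suc x∈′
  ...   | _ , y∈ , refl = onto y∈

descending-unique : ∀ {m} (T : Growth m) {l} → Linked (ArcOf T) l → Unique l
descending-unique T lk = AllPairs.map (λ { y<x refl → ℕ.<-irrefl refl y<x })
  (Linked.Linked⇒AllPairs (λ y<x z<y → ℕ.<-trans z<y y<x) (Linked.map (arc-< T) lk))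

growth-path : ∀ {m} (T : Growth m) {S : Fin m → Set} → Decidable₁ S → Subtree T S → Unbranched T S →
              ∃[ x ] S x →
              Σ[ P ∈ DirectedPath (growth-tree T) ] ((∀ {x} → S x → x ∈ nodes P) × (∀ {x} → x ∈ nodes P → S x))
growth-path T S? sub unbranched (x , sx) with descending-list T S? sub unbranched
... | [] , _ , into , _ with into sx
...   | ()
growth-path T S? sub unbranched (x , sx) | h ∷ t , lk , into , onto =
  record { first = h ; rest = t ; linked = lk ; distinct = descending-unique T lk } , into , onto

-- The predecessor of `y` on the path is a parent of `y`, hence equal to `x`. Nor can `y` come
-- first, since indices decrease along the path and `x` has the larger index.
path-arc : ∀ {m} (T : Growth m) (P : DirectedPath (growth-tree T)) {x y} → x ∈ nodes P → y ∈ nodes P →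
           ArcOf T x y →
           (x , y) ∈ arcs P
path-arc T P {x} {y} x∈ y∈ xy with y∈
... | there y∈′ = predecessor (linked P) y∈′
  where
  predecessor : ∀ {h t} → Linked (ArcOf T) (h ∷ t) → y ∈ t → (x , y) ∈ zip (h ∷ t) t
  predecessor (hy ∷ _) (here refl) = here (cong (_, _) (parent-unique T xy hy))
  predecessor (_ ∷ lk) (there y∈) = there (predecessor lk y∈)
... | here refl = ⊥-elim (ℕ.<⇒≱ (arc-< T xy) (below (linked P) x∈))
  where
  below : ∀ {h l} → Linked (ArcOf T) (h ∷ l) → x ∈ h ∷ l → toℕ x ≤ toℕ h
  below _ (here refl) = ℕ.≤-refl
  below (a ∷ lk) (there x∈) = ℕ.≤-trans (below lk x∈) (ℕ.<⇒≤ (arc-< T a))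

-- Clique trees

subtree-cong : ∀ {m} (T : Growth m) {S S′ : Fin m → Set} → (∀ {x} → S x → S′ x) → (∀ {x} → S′ x → S x) →
               Subtree T S → Subtree T S′
subtree-cong root _ _ _ = tt
subtree-cong (leaf p T) {S} {S′} to from (sub , attached) = subtree-cong T to from sub , attached′
  where
  attached′ : S′ zero → S′ (suc p) ⊎ (∀ x → ¬ S′ (suc x))
  attached′ s with attached (from s)
  ... | inj₁ sp = inj₁ (to sp)
  ... | inj₂ none = inj₂ λ x → none x ∘ from

subtree-point : ∀ {m} (T : Growth m) {S : Fin m → Set} → (∀ {x y} → S x → S y → x ≡ y) → Subtree T S
subtree-point root _ = tt
subtree-point (leaf p T) {S} point =
  subtree-point T (λ sx sy → suc-injective (point sx sy)) , λ s → inj₂ λ x sx → 0≢1+n (point s sx)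

module _ {n : ℕ} (G : Graph (Fin n)) where

  Clique : (Fin n → Set) → Set
  Clique K = ∀ {u v} → K u → K v → u ≢ v → Adj G u v

  -- `clique`, `cover` and `antichain` together say that the bags are the maximal cliques of the
  -- subgraph induced on `L`, each occurring once.
  record CliqueTree (L : List (Fin n)) (r : Fin n) : Set₁ where
    field
      {order} : ℕ
      growth  : Growth order
      Bag     : Fin order → Fin n → Set
      bag?    : ∀ x → Decidable₁ (Bag x)
      within  : ∀ {x v} → Bag x v → v ∈ L
      clique  : ∀ x → Clique (Bag x)
      cover   : ∀ {K} → Decidable₁ K → (∀ {v} → K v → v ∈ L) → Clique K → ∃[ x ] (∀ {v} → K v → Bag x v)
      antichain : ∀ {x y} → (∀ {v} → Bag x v → Bag y v) → x ≡ y
      subtree : ∀ v → Subtree growth (λ x → Bag x v)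
      top-bag : Bag (top growth) r

  module _ {s r : Fin n} {L : List (Fin n)} (s∉L : s ∉ L) (simplicial : Simplicial G L s) (C : CliqueTree L r) where

    open CliqueTree C

    private
      N : Fin n → Set
      N v = v ∈ L × Adj G s v

      N? : Decidable₁ N
      N? v = _∈?_ _≟_ v L ×-dec adj? G s v

      ¬bag-s : ∀ {x} → ¬ Bag x s
      ¬bag-s = s∉L ∘ within

      below : ∀ {v} → v ∈ s ∷ L → v ≢ s → v ∈ L
      below (here e) v≢s = ⊥-elim (v≢s e)
      below (there v∈) _ = v∈

      clique-∋s : ∀ {K} → (∀ {v} → K v → v ∈ s ∷ L) → Clique K → K s → ∀ {v} → K v → v ≡ s ⊎ N v
      clique-∋s K⊆ K-clique ks {v} kv with v ≟ s
      ... | yes v≡s = inj₁ v≡s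
      ... | no v≢s = inj₂ (below (K⊆ kv) v≢s , K-clique ks kv (v≢s ∘ sym))

      clique-∌s : ∀ {K} → Decidable₁ K → (∀ {v} → K v → v ∈ s ∷ L) → Clique K → ¬ K s →
                  ∃[ x ] (∀ {v} → K v → Bag x v)
      clique-∌s K? K⊆ K-clique ¬ks = cover K? (λ kv → below (K⊆ kv) λ { refl → ¬ks kv }) K-clique

    -- Here the neighbourhood of `s` in `L` is itself the bag of `t`. With `s` present it is no
    -- longer maximal, so its node is reused.
    enlarge-bag : ∀ t → (∀ {v} → N v → Bag t v) → (∀ {v} → Bag t v → Adj G s v) → CliqueTree (s ∷ L) r
    enlarge-bag t N⊆t t⊆N = record
      { growth = growth
      ; Bag = Bag′
      ; bag? = λ x v → bag? x v ⊎-dec ((x ≟ t) ×-dec (v ≟ s))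
      ; within = λ { (inj₁ b) → there (within b) ; (inj₂ (_ , e)) → here e }
      ; clique = clique′
      ; cover = cover′
      ; antichain = λ sub → antichain λ b → old b (sub (inj₁ b))
      ; subtree = subtree′
      ; top-bag = inj₁ top-bag
      }
      where
      Bag′ : Fin order → Fin n → Set
      Bag′ x v = Bag x v ⊎ (x ≡ t × v ≡ s)

      old : ∀ {x y v} → Bag x v → Bag′ y v → Bag y v
      old _ (inj₁ b) = b
      old b (inj₂ (_ , refl)) = ⊥-elim (¬bag-s b)

      clique′ : ∀ x → Clique (Bag′ x)
      clique′ x (inj₁ a) (inj₁ b) u≢v = clique x a b u≢v
      clique′ x (inj₁ a) (inj₂ (refl , refl)) _ = adj-sym G (t⊆N a)
      clique′ x (inj₂ (refl , refl)) (inj₁ b) _ = t⊆N b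
      clique′ x (inj₂ (_ , refl)) (inj₂ (_ , refl)) u≢v = ⊥-elim (u≢v refl)

      cover′ : ∀ {K} → Decidable₁ K → (∀ {v} → K v → v ∈ s ∷ L) → Clique K → ∃[ x ] (∀ {v} → K v → Bag′ x v)
      cover′ {K} K? K⊆ K-clique with K? s
      ... | no ¬ks = let x , K⊆x = clique-∌s K? K⊆ K-clique ¬ks in x , inj₁ ∘ K⊆x
      ... | yes ks = t , λ kv → place (clique-∋s K⊆ K-clique ks kv)
        where
        place : ∀ {v} → v ≡ s ⊎ N v → Bag′ t v
        place (inj₁ e) = inj₂ (refl , e)
        place (inj₂ nv) = inj₁ (N⊆t nv)

      subtree′ : ∀ v → Subtree growth (λ x → Bag′ x v)
      subtree′ v with v ≟ s
      ... | no v≢s = subtree-cong growth inj₁ (λ { (inj₁ b) → b ; (inj₂ (_ , e)) → ⊥-elim (v≢s e) }) (subtree v)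
      ... | yes refl = subtree-point growth point
        where
        point : ∀ {x y} → Bag′ x s → Bag′ y s → x ≡ y
        point (inj₁ b) _ = ⊥-elim (¬bag-s b)
        point (inj₂ _) (inj₁ b) = ⊥-elim (¬bag-s b)
        point (inj₂ (refl , _)) (inj₂ (refl , _)) = refl

    -- An old bag inside the new one would lie in the neighbourhood of `s`, hence in the bag of `t`,
    -- hence be that bag; but `v₀` keeps the bag of `t` out of the new one.
    new-bag : ∀ t {v₀} → (∀ {v} → N v → Bag t v) → Bag t v₀ → ¬ Adj G s v₀ → CliqueTree (s ∷ L) r
    new-bag t {v₀} N⊆t v₀∈t ¬sv₀ = record
      { growth = leaf t growth
      ; Bag = Bag′
      ; bag? = λ { zero v → (v ≟ s) ⊎-dec N? v ; (suc x) v → bag? x v }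
      ; within = λ { {zero} (inj₁ e) → here e ; {zero} (inj₂ (v∈ , _)) → there v∈ ; {suc x} b → there (within b) }
      ; clique = clique′
      ; cover = cover′
      ; antichain = λ {x} {y} → antichain′ x y
      ; subtree = λ v → subtree v , attached
      ; top-bag = top-bag
      }
      where
      Bag′ : Fin (ℕ.suc order) → Fin n → Set
      Bag′ zero v = v ≡ s ⊎ N v
      Bag′ (suc x) v = Bag x v

      clique′ : ∀ x → Clique (Bag′ x)
      clique′ zero (inj₁ refl) (inj₁ refl) u≢v = ⊥-elim (u≢v refl)
      clique′ zero (inj₁ refl) (inj₂ (_ , sv)) _ = sv
      clique′ zero (inj₂ (_ , su)) (inj₁ refl) _ = adj-sym G su
      clique′ zero (inj₂ (u∈ , su)) (inj₂ (v∈ , sv)) u≢v = simplicial u∈ v∈ su sv u≢v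
      clique′ (suc x) = clique x

      cover′ : ∀ {K} → Decidable₁ K → (∀ {v} → K v → v ∈ s ∷ L) → Clique K → ∃[ x ] (∀ {v} → K v → Bag′ x v)
      cover′ {K} K? K⊆ K-clique with K? s
      ... | no ¬ks = let x , K⊆x = clique-∌s K? K⊆ K-clique ¬ks in suc x , K⊆x
      ... | yes ks = zero , clique-∋s K⊆ K-clique ks

      antichain′ : ∀ x y → (∀ {v} → Bag′ x v → Bag′ y v) → x ≡ y
      antichain′ zero zero _ = refl
      antichain′ zero (suc y) sub = ⊥-elim (¬bag-s (sub (inj₁ refl)))
      antichain′ (suc x) (suc y) sub = cong suc (antichain sub)
      antichain′ (suc x) zero sub with antichain {x} {t} (λ b → N⊆t (old b))
        where
        old : ∀ {v} → Bag x v → N v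
        old b with sub b
        ... | inj₁ refl = ⊥-elim (¬bag-s b)
        ... | inj₂ nv = nv
      ... | refl with sub v₀∈t
      ...   | inj₁ refl = ⊥-elim (¬bag-s v₀∈t)
      ...   | inj₂ (_ , sv₀) = ⊥-elim (¬sv₀ sv₀)

      attached : ∀ {v} → Bag′ zero v → Bag t v ⊎ (∀ x → ¬ Bag x v)
      attached (inj₁ refl) = inj₂ λ _ → ¬bag-s
      attached (inj₂ nv) = inj₁ (N⊆t nv)

    insert-simplicial : CliqueTree (s ∷ L) r
    insert-simplicial with cover N? proj₁ (λ (u∈ , su) (v∈ , sv) → simplicial u∈ v∈ su sv)
    ... | t , N⊆t with anyFin? (λ v → bag? t v ×-dec ¬? (adj? G s v))
    ...   | yes (_ , v₀∈t , ¬sv₀) = new-bag t N⊆t v₀∈t ¬sv₀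
    ...   | no full = enlarge-bag t N⊆t λ {v} v∈t → decidable-stable (adj? G s v) λ ¬sv → full (v , v∈t , ¬sv)

  clique-tree : ∀ {r L} → EliminationOrder G r L → CliqueTree L r
  clique-tree {r} last = record
    { growth = root
    ; Bag = λ _ v → v ≡ r
    ; bag? = λ _ v → v ≟ r
    ; within = here
    ; clique = λ { _ refl refl u≢v → ⊥-elim (u≢v refl) }
    ; cover = λ _ K⊆ _ → zero , λ kv → only (K⊆ kv)
    ; antichain = λ { {zero} {zero} _ → refl }
    ; subtree = λ _ → tt
    ; top-bag = refl
    }
    where
    only : ∀ {v} → v ∈ r ∷ [] → v ≡ r
    only (here e) = e
  clique-tree ((s∉ , simplicial) ∷ order) = insert-simplicial s∉ simplicial (clique-tree order)

-- Local structure of a clique tree without claw and 3-sun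

module _ {n : ℕ} {G : Graph (Fin n)} {L : List (Fin n)} {r : Fin n}
         (C : CliqueTree G L r) (spanning : ∀ v → v ∈ L) where

  open CliqueTree C

  private
    T : Graph (Fin order)
    T = growth-graph growth

    acyclic : Acyclic T
    acyclic = growth-acyclic growth

    Meet : Fin n → Fin n → Set
    Meet u v = ∃[ x ] (Bag x u × Bag x v)

    adj⇒Meet : ∀ {u v} → Adj G u v → Meet u v
    adj⇒Meet {u} {v} uv =
      let x , K⊆x = cover (λ w → (w ≟ u) ⊎-dec (w ≟ v)) (λ {w} _ → spanning w) pair
      in x , K⊆x (inj₁ refl) , K⊆x (inj₂ refl)
      where
      pair : Clique G (λ w → w ≡ u ⊎ w ≡ v)
      pair (inj₁ refl) (inj₁ refl) p = ⊥-elim (p refl)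
      pair (inj₁ refl) (inj₂ refl) _ = uv
      pair (inj₂ refl) (inj₁ refl) _ = adj-sym G uv
      pair (inj₂ refl) (inj₂ refl) p = ⊥-elim (p refl)

    adjacent : ∀ {x y u v} → Bag x u → Bag x v → Bag y u → ¬ Bag y v → Adj G u v
    adjacent {x} xu xv yu ¬yv = clique x xu xv λ { refl → ¬yv yu }

    bags-connected : ∀ v → ConnectedIn _≟_ T (λ x → Bag x v)
    bags-connected v = subtree-connected growth (subtree v)

    union : ∀ {u v} → Meet u v → ConnectedIn _≟_ T (λ x → Bag x u ⊎ Bag x v)
    union (_ , p , q) = union-connected _≟_ T (bags-connected _) (bags-connected _) p q

    union? : ∀ u v → Decidable₁ (λ x → Bag x u ⊎ Bag x v)
    union? u v x = bag? x u ⊎-dec bag? x v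

    tree-convex : ∀ {l} → Linked (Adj T) l → Unique l → ∀ {Q : Fin order → Set} → Decidable₁ Q →
                  ConnectedIn _≟_ T Q →
                  ∀ {a z b} → Before a z l → Before z b l → Q a → Q b → Q z
    tree-convex = convex _≟_ T acyclic

  difference : ∀ {x y} → x ≢ y → ∃[ w ] (Bag x w × ¬ Bag y w)
  difference {x} {y} x≢y with anyFin? (λ w → bag? x w ×-dec ¬? (bag? y w))
  ... | yes d = d
  ... | no none = ⊥-elim (x≢y (antichain λ {v} b → decidable-stable (bag? y v) λ ¬b → none (v , b , ¬b)))

  tree-≢ : ∀ {x y} → Adj T x y → x ≢ y
  tree-≢ a refl = adj-irr T refl a

  between : ∀ {t a b} → Adj T t a → Adj T t b → a ≢ b → ∀ {Q : Fin order → Set} → Decidable₁ Q →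
            ConnectedIn _≟_ T Q →
            Q a → Q b → Q t
  between {t} {a} {b} ta tb a≢b Q? con = tree-convex (adj-sym T ta ∷ tb ∷ [-])
    ((tree-≢ (adj-sym T ta) ∷ a≢b ∷ []) ∷ (tree-≢ tb ∷ []) ∷ [] ∷ []) Q? con
    (here (here refl)) (there (here (here refl)))

  -- If `w` and `w′` met, the union of their node sets would be connected and contain `a` and `b`,
  -- hence also `t`.
  branches-apart : ∀ {t a b w w′} → Adj T t a → Adj T t b → a ≢ b → Bag a w → ¬ Bag t w → Bag b w′ →
                   ¬ Bag t w′ → ¬ Meet w w′
  branches-apart ta tb a≢b aw ¬tw bw′ ¬tw′ meet
    with between ta tb a≢b (union? _ _) (union meet) (inj₁ aw) (inj₂ bw′)
  ... | inj₁ tw = ¬tw tw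
  ... | inj₂ tw′ = ¬tw′ tw′

  -- Through a common node the two sets would join the ends of the edge without using it.
  edge-apart : ∀ {t a x w} → Adj T t a → Bag t x → ¬ Bag a x → Bag a w → ¬ Bag t w → ¬ Meet x w
  edge-apart {x = x} {w} ta tx ¬ax aw ¬tw (z , zx , zw) = bridge _≟_ T acyclic ta
    (off _≟_ T (¬ax ∘ proj₂) (bags-connected x tx zx) ◅◅ off _≟_ T (¬tw ∘ proj₁) (bags-connected w zw aw))

  -- A walk of `G` from one bag to the other is traced in the tree, each of its vertices
  -- contributing a walk inside its own node set. If no vertex occupied both ends, the trace would
  -- avoid the edge.
  edge-meets : Connected G → ∀ {x y} → Adj T x y → ∃[ u ] (Bag x u × Bag y u)
  edge-meets (_ , connected) {x} {y} xy with anyFin? (λ u → bag? x u ×-dec bag? y u)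
  ... | yes shared = shared
  ... | no disjoint = let w , xw , _ = difference (tree-≢ xy)
                          w′ , yw′ , _ = difference (tree-≢ (adj-sym T xy))
                      in ⊥-elim (bridge _≟_ T acyclic xy (trace (connected w w′) xw yw′))
    where
    stay : ∀ {u a b} → Bag a u → Bag b u → Star (Off _≟_ T x y) a b
    stay {u} p q = off _≟_ T (λ (xu , yu) → disjoint (u , xu , yu)) (bags-connected u p q)

    trace : ∀ {w w′ a b} → Star (Adj G) w w′ → Bag a w → Bag b w′ → Star (Off _≟_ T x y) a b
    trace ε p q = stay p q
    trace (ww₁ ◅ s) p q with adj⇒Meet ww₁
    ... | _ , p′ , p₁ = stay p p′ ◅◅ trace s p₁ q

  module _ (clawFree : ClawFree G) where

    no-claw : ∀ {c a b d} → Adj G c a → Adj G c b → Adj G c d → ¬ Meet a b → ¬ Meet a d → ¬ Meet b d → ⊥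
    no-claw {c} {a} {b} {d} ca cb cd ab ad bd = clawFree (f , injective , λ i j → mk⇔ (to i j) (from i j))
      where
      leg : Fin 3 → Fin n
      leg zero = a
      leg (suc zero) = b
      leg (suc (suc zero)) = d

      f : Fin 4 → Fin n
      f zero = c
      f (suc i) = leg i

      centre : ∀ i → Adj G c (leg i)
      centre zero = ca
      centre (suc zero) = cb
      centre (suc (suc zero)) = cd

      flip-meet : ∀ {u v} → Meet u v → Meet v u
      flip-meet (x , p , q) = x , q , p

      apart : ∀ i j → i ≢ j → ¬ Meet (leg i) (leg j)
      apart zero zero i≢j = ⊥-elim (i≢j refl)
      apart zero (suc zero) _ = ab
      apart zero (suc (suc zero)) _ = ad
      apart (suc zero) zero _ = ab ∘ flip-meet
      apart (suc zero) (suc zero) i≢j = ⊥-elim (i≢j refl)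
      apart (suc zero) (suc (suc zero)) _ = bd
      apart (suc (suc zero)) zero _ = ad ∘ flip-meet
      apart (suc (suc zero)) (suc zero) _ = bd ∘ flip-meet
      apart (suc (suc zero)) (suc (suc zero)) i≢j = ⊥-elim (i≢j refl)

      leg-injective : ∀ i j → leg i ≡ leg j → i ≡ j
      leg-injective i j e = decidable-stable (i ≟ j) λ i≢j →
        let x , _ , q = adj⇒Meet (centre i) in apart i j i≢j (x , q , subst (Bag x) e q)

      injective : ∀ {i j} → f i ≡ f j → i ≡ j
      injective {zero} {zero} _ = refl
      injective {zero} {suc j} e = ⊥-elim (adj-irr G e (centre j))
      injective {suc i} {zero} e = ⊥-elim (adj-irr G (sym e) (centre i))
      injective {suc i} {suc j} e = cong suc (leg-injective i j e)

      to : ∀ i j → Adj claw i j → Adj G (f i) (f j)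
      to zero (suc j) _ = centre j
      to (suc i) zero _ = adj-sym G (centre i)

      from : ∀ i j → Adj G (f i) (f j) → Adj claw i j
      from zero zero e = ⊥-elim (adj-irr G refl e)
      from zero (suc j) _ = tt
      from (suc i) zero _ = tt
      from (suc i) (suc j) e = apart i j (λ { refl → adj-irr G refl e }) (adj⇒Meet e)

    three-branches : ∀ {t a b c v} → Adj T t a → Adj T t b → Adj T t c → a ≢ b → a ≢ c → b ≢ c →
                     Bag t v → Bag a v → Bag b v → ¬ Bag c v
    three-branches ta tb tc a≢b a≢c b≢c tv av bv cv
      with difference (tree-≢ (adj-sym T ta)) | difference (tree-≢ (adj-sym T tb)) | difference (tree-≢ (adj-sym T tc))
    ... | wa , awa , ¬twa | wb , bwb , ¬twb | wc , cwc , ¬twc =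
      no-claw (adjacent av awa tv ¬twa) (adjacent bv bwb tv ¬twb) (adjacent cv cwc tv ¬twc)
        (branches-apart ta tb a≢b awa ¬twa bwb ¬twb) (branches-apart ta tc a≢c awa ¬twa cwc ¬twc)
        (branches-apart tb tc b≢c bwb ¬twb cwc ¬twc)

    -- Otherwise `v` would be the centre of a claw whose leaves are `u`, a vertex beyond `a` and a
    -- vertex beyond `b`.
    passing-through : ∀ {t a b v u} → Adj T t a → Adj T t b → a ≢ b → Bag t v → Bag a v → Bag b v →
                      Bag t u → ¬ Bag a u → Bag b u
    passing-through {b = b} {u = u} ta tb a≢b tv av bv tu ¬au
      with difference (tree-≢ (adj-sym T ta)) | difference (tree-≢ (adj-sym T tb))
    ... | wa , awa , ¬twa | wb , bwb , ¬twb = decidable-stable (bag? b u) λ ¬bu →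
      no-claw (adjacent tv tu av ¬au) (adjacent av awa tv ¬twa) (adjacent bv bwb tv ¬twb)
        (edge-apart ta tu ¬au awa ¬twa) (edge-apart tb tu ¬bu bwb ¬twb)
        (branches-apart ta tb a≢b awa ¬twa bwb ¬twb)

    -- The outer vertices are found beyond the branches: `u i` occupies `branch i` but not `t`, and
    -- is met by exactly the two corners that enter `branch i`.
    no-sun : 3-SunFree G → ∀ {t} (branch : Fin 3 → Fin order) (v : Fin 3 → Fin n) →
             (∀ i → Adj T t (branch i)) →
             (∀ i j → i ≢ j → branch i ≢ branch j) → (∀ i → Bag t (v i)) →
             (∀ i j → i ≢ j → Bag (branch j) (v i)) →
             (∀ i → ¬ Bag (branch i) (v i)) → ⊥
    no-sun sunFree {t} branch v edge branch≢ tv on off′ = sunFree (f , injective , λ x y → mk⇔ (to x y) (from x y))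
      where
      tip : ∀ i → ∃[ w ] (Bag (branch i) w × ¬ Bag t w)
      tip i = difference (tree-≢ (adj-sym T (edge i)))

      u : Fin 3 → Fin n
      u i = proj₁ (tip i)

      f : Fin 3 ⊎ Fin 3 → Fin n
      f (inj₁ i) = v i
      f (inj₂ i) = u i

      tips-apart : ∀ {i j} → i ≢ j → ¬ Meet (u i) (u j)
      tips-apart {i} {j} i≢j = branches-apart (edge i) (edge j) (branch≢ i j i≢j)
        (proj₁ (proj₂ (tip i))) (proj₂ (proj₂ (tip i))) (proj₁ (proj₂ (tip j))) (proj₂ (proj₂ (tip j)))

      v-u : ∀ {i j} → i ≢ j → Adj G (v i) (u j)
      v-u {i} {j} i≢j = adjacent (on i j i≢j) (proj₁ (proj₂ (tip j))) (tv i) (proj₂ (proj₂ (tip j)))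

      ¬v-u : ∀ {i} → ¬ Adj G (v i) (u i)
      ¬v-u {i} e = edge-apart (edge i) (tv i) (off′ i) (proj₁ (proj₂ (tip i))) (proj₂ (proj₂ (tip i))) (adj⇒Meet e)

      injective : ∀ {x y} → f x ≡ f y → x ≡ y
      injective {inj₁ i} {inj₁ j} e = cong inj₁ (decidable-stable (i ≟ j) λ i≢j →
        off′ j (subst (Bag (branch j)) e (on i j i≢j)))
      injective {inj₁ i} {inj₂ j} e = ⊥-elim (proj₂ (proj₂ (tip j)) (subst (Bag t) e (tv i)))
      injective {inj₂ i} {inj₁ j} e = ⊥-elim (proj₂ (proj₂ (tip i)) (subst (Bag t) (sym e) (tv j)))
      injective {inj₂ i} {inj₂ j} e = cong inj₂ (decidable-stable (i ≟ j) λ i≢j →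
        tips-apart i≢j (branch i , proj₁ (proj₂ (tip i)) , subst (Bag (branch i)) e (proj₁ (proj₂ (tip i)))))

      to : ∀ x y → Adj 3-sun x y → Adj G (f x) (f y)
      to (inj₁ i) (inj₁ j) i≢j = clique t (tv i) (tv j) λ e → i≢j (inj₁-injective (injective {inj₁ i} {inj₁ j} e))
        where
        inj₁-injective : ∀ {i j : Fin 3} → _≡_ {A = Fin 3 ⊎ Fin 3} (inj₁ i) (inj₁ j) → i ≡ j
        inj₁-injective refl = refl
      to (inj₁ i) (inj₂ j) i≢j = v-u i≢j
      to (inj₂ i) (inj₁ j) i≢j = adj-sym G (v-u (i≢j ∘ sym))

      from : ∀ x y → Adj G (f x) (f y) → Adj 3-sun x y
      from (inj₁ i) (inj₁ j) e refl = adj-irr G refl e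
      from (inj₁ i) (inj₂ j) e refl = ¬v-u e
      from (inj₂ i) (inj₁ j) e refl = ¬v-u (adj-sym G e)
      from (inj₂ i) (inj₂ j) e = tips-apart (λ { refl → adj-irr G refl e }) (adj⇒Meet e)

    private
      -- Two corners of the sun are given. The third is a vertex `y` of the bag of `t` missing from
      -- the branch `a` that `v` and `u` share; `passing-through`, applied along `v` and along `u`,
      -- puts `y` into both `b` and `c`.
      crossroad : 3-SunFree G → ∀ {t a b c v u} → Adj T t a → Adj T t b → Adj T t c → a ≢ b → a ≢ c →
                  b ≢ c →
                  Bag t v → Bag a v → Bag b v → ¬ Bag c v → Bag t u → Bag c u → Bag a u → ¬ Bag b u → ⊥
      crossroad sunFree {t} {a} {b} {c} {v} {u} ta tb tc a≢b a≢c b≢c tv av bv ¬cv tu cu au ¬bu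
        with difference (tree-≢ ta)
      ... | y , ty , ¬ay = no-sun sunFree branch corner edge branch≢ t∋ on off′
        where
        by = passing-through ta tb a≢b tv av bv ty ¬ay
        cy = passing-through ta tc a≢c tu au cu ty ¬ay

        branch : Fin 3 → Fin order
        branch zero = c
        branch (suc zero) = b
        branch (suc (suc zero)) = a

        corner : Fin 3 → Fin n
        corner zero = v
        corner (suc zero) = u
        corner (suc (suc zero)) = y

        edge : ∀ i → Adj T t (branch i)
        edge zero = tc
        edge (suc zero) = tb
        edge (suc (suc zero)) = ta

        branch≢ : ∀ i j → i ≢ j → branch i ≢ branch j
        branch≢ zero zero i≢j = ⊥-elim (i≢j refl)
        branch≢ zero (suc zero) _ = b≢c ∘ sym
        branch≢ zero (suc (suc zero)) _ = a≢c ∘ sym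
        branch≢ (suc zero) zero _ = b≢c
        branch≢ (suc zero) (suc zero) i≢j = ⊥-elim (i≢j refl)
        branch≢ (suc zero) (suc (suc zero)) _ = a≢b ∘ sym
        branch≢ (suc (suc zero)) zero _ = a≢c
        branch≢ (suc (suc zero)) (suc zero) _ = a≢b
        branch≢ (suc (suc zero)) (suc (suc zero)) i≢j = ⊥-elim (i≢j refl)

        t∋ : ∀ i → Bag t (corner i)
        t∋ zero = tv
        t∋ (suc zero) = tu
        t∋ (suc (suc zero)) = ty

        on : ∀ i j → i ≢ j → Bag (branch j) (corner i)
        on zero zero i≢j = ⊥-elim (i≢j refl)
        on zero (suc zero) _ = bv
        on zero (suc (suc zero)) _ = av
        on (suc zero) zero _ = cu
        on (suc zero) (suc zero) i≢j = ⊥-elim (i≢j refl)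
        on (suc zero) (suc (suc zero)) _ = au
        on (suc (suc zero)) zero _ = cy
        on (suc (suc zero)) (suc zero) _ = by
        on (suc (suc zero)) (suc (suc zero)) i≢j = ⊥-elim (i≢j refl)

        off′ : ∀ i → ¬ Bag (branch i) (corner i)
        off′ zero = ¬cv
        off′ (suc zero) = ¬bu
        off′ (suc (suc zero)) = ¬ay

    -- The cases are how the vertex `u` shared by `t` and `c` continues: into both `a` and `b` gives
    -- a claw, into exactly one a `crossroad`, and into neither contradicts `passing-through`.
    no-third-branch : 3-SunFree G → Connected G → ∀ {t a b c v} → Adj T t a → Adj T t b → a ≢ b → Bag t v →
                      Bag a v → Bag b v →
                      Adj T t c → a ≢ c → b ≢ c → ⊥
    no-third-branch sunFree connected {t} {a} {b} {c} {v} ta tb a≢b tv av bv tc a≢c b≢c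
      with edge-meets connected tc
    ... | u , tu , cu with bag? a u | bag? b u
    ... | yes au | yes bu = three-branches ta tb tc a≢b a≢c b≢c tu au bu cu
    ... | yes au | no ¬bu = crossroad sunFree ta tb tc a≢b a≢c b≢c tv av bv ¬cv tu cu au ¬bu
      where ¬cv = three-branches ta tb tc a≢b a≢c b≢c tv av bv
    ... | no ¬au | yes bu = crossroad sunFree tb ta tc (a≢b ∘ sym) b≢c a≢c tv bv av ¬cv tu cu bu ¬au
      where ¬cv = three-branches ta tb tc a≢b a≢c b≢c tv av bv
    ... | no ¬au | no ¬bu = ¬bu (passing-through ta tb a≢b tv av bv tu ¬au)

    -- If `r` were in the bag of a child, simpliciality would make a vertex only in the root bag
    -- adjacent to one only in that child's bag. But a path from `a` to `b` would carry `r` into `a`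
    -- or `b`.
    top-unbranched : Simplicial G (allFin n) r → ∀ {a b v} → Adj T (top growth) a → Adj T (top growth) b →
                     a ≢ b →
                     Bag (top growth) v → Bag a v → ¬ Bag b v
    top-unbranched simplicial ta tb a≢b tv av bv = ¬r tb (passing-through ta tb a≢b tv av bv top-bag (¬r ta))
      where
      ¬r : ∀ {a} → Adj T (top growth) a → ¬ Bag a r
      ¬r ta ar with difference (tree-≢ ta) | difference (tree-≢ (adj-sym T ta))
      ... | y , ty , ¬ay | w , aw , ¬tw = edge-apart ta ty ¬ay aw ¬tw (adj⇒Meet
        (simplicial (∈-allFin y) (∈-allFin w) (adjacent top-bag ty ar ¬ay) (adjacent ar aw top-bag ¬tw)
          λ { refl → ¬tw ty }))

    unbranched : 3-SunFree G → Connected G → Simplicial G (allFin n) r → ∀ v →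
                 Unbranched growth (λ x → Bag x v)
    unbranched sunFree connected simplicial v {t} {a} {b} ta tb av bv = decidable-stable (a ≟ b) λ a≢b →
      let tv = between (inj₁ ta) (inj₁ tb) a≢b (λ x → bag? x v) (bags-connected v) av bv
      in at a≢b tv (parent growth t)
      where
      at : a ≢ b → Bag t v → t ≡ top growth ⊎ (∃[ p ] ArcOf growth p t) → ⊥
      at a≢b tv (inj₁ refl) = top-unbranched simplicial (inj₁ ta) (inj₁ tb) a≢b tv av bv
      at a≢b tv (inj₂ (p , pt)) =
        no-third-branch sunFree connected (inj₁ ta) (inj₁ tb) a≢b tv av bv (inj₂ pt) (above ta) (above tb)
        where
        above : ∀ {a} → ArcOf growth t a → a ≢ p
        above ta refl = ℕ.<-asym (arc-< growth ta) (arc-< growth pt)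

    exit : ∀ {Q : Fin order → Set} → Decidable₁ Q → ∀ {h y t} → Linked (Adj T) (h ∷ t) → Q h → y ∈ t →
           ¬ Q y →
           ∃[ a ] ∃[ b ] (Adj T a b × Q a × ¬ Q b × a ∈ h ∷ t × Before a b (h ∷ t))
    exit Q? {h} {y} {h′ ∷ t} (r ∷ lk) qh y∈ ¬qy with Q? h′ | y∈
    ... | no ¬qh′ | _ = h , h′ , r , qh , ¬qh′ , here refl , here (here refl)
    ... | yes qh′ | here refl = ⊥-elim (¬qy qh′)
    ... | yes qh′ | there y∈′ with exit Q? lk qh′ y∈′ ¬qy
    ...   | a , b , ab , qa , ¬qb , a∈ , a<b = a , b , ab , qa , ¬qb , there a∈ , there a<b

    -- If the path of `u` entered the nodes of `v` from `h` to `h′` and later left them from `a` to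
    -- `b`, then `u` would be the centre of a claw with leaves `v`, a vertex `w` of `h` missing from
    -- `h′`, and a vertex `w′` of `b` missing from `a`.
    no-return : ∀ {u v} → u ≢ v → ∀ {h h′ t y} → Linked (Adj T) (h ∷ h′ ∷ t) → Unique (h ∷ h′ ∷ t) →
                (∀ {x} → x ∈ h ∷ h′ ∷ t → Bag x u) →
                ¬ Bag h v → Bag h′ v → y ∈ t → Bag y v
    no-return {u} {v} u≢v {h} {h′} {t} {y} l@(hh′ ∷ lk) us on-u ¬hv h′v y∈ =
      decidable-stable (bag? y v) λ ¬yv → absurd (exit (λ x → bag? x v) lk h′v y∈ ¬yv)
      where
      absurd : ¬ (∃[ a ] ∃[ b ] (Adj T a b × Bag a v × ¬ Bag b v × a ∈ h′ ∷ t × Before a b (h′ ∷ t)))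
      absurd (a , b , ab , av , ¬bv , a∈ , a<b) with difference (tree-≢ hh′) | difference (tree-≢ (adj-sym T ab))
      ... | w , hw , ¬h′w | w′ , bw′ , ¬aw′ = no-claw
        (clique h′ (on-u (there (here refl))) h′v u≢v)
        (adjacent (on-u (here refl)) hw (on-u (there (here refl))) ¬h′w)
        (adjacent (on-u (there (before-∈ʳ a<b))) bw′ (on-u (there a∈)) ¬aw′)
        (edge-apart (adj-sym T hh′) h′v ¬hv hw ¬h′w) (edge-apart ab av ¬bv bw′ ¬aw′) ends-apart
        where
        h′≤a : a ≡ h′ ⊎ Before h′ a (h ∷ h′ ∷ t)
        h′≤a = Sum.map₂ there (before-head a∈)

        h′<b : Before h′ b (h ∷ h′ ∷ t)
        h′<b with h′≤a
        ... | inj₁ refl = there a<b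
        ... | inj₂ h′<a = before-trans us h′<a (there a<b)

        -- If they met, their union would contain every node from `h` to `b`; so `h′` would belong
        -- to `w′` and `a` to `w`. Then `w` would contain `h` and `a` but not `h′` between them.
        ends-apart : ¬ Meet w w′
        ends-apart meet
          with tree-convex l us (union? w w′) (union meet) (here (here refl)) h′<b (inj₁ hw) (inj₂ bw′)
             | tree-convex l us (union? w w′) (union meet) (here a∈) (there a<b) (inj₁ hw) (inj₂ bw′)
             | h′≤a
        ... | inj₁ h′w | _ | _ = ¬h′w h′w
        ... | inj₂ _ | inj₂ aw′ | _ = ¬aw′ aw′
        ... | inj₂ h′w′ | inj₁ _ | inj₁ refl = ¬aw′ h′w′
        ... | inj₂ _ | inj₁ aw | inj₂ h′<a =
          ¬h′w (tree-convex l us (λ x → bag? x w) (bags-connected w) (here (here refl)) h′<a hw aw)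

    -- By `no-return`, all of `P` between two nodes outside `Q` is outside `Q`, so the segment of
    -- `P` itself is the required walk.
    difference-connected : ∀ {u v} → u ≢ v → (P Q : DirectedPath (growth-tree growth)) →
                           (∀ {x} → x ∈ nodes P → Bag x u) →
                           (∀ {x} → Bag x v → x ∈ nodes Q) → (∀ {x} → x ∈ nodes Q → Bag x v) →
                           DifferenceConnected P Q
    difference-connected {u} {v} u≢v P Q P⊆ into onto x∈ x∉ y∈ y∉ =
      connect x∈ x∉ y∈ y∉
      where
      Step : Rel (Fin order) 0ℓ
      Step a b = a ∉ nodes Q × b ∉ nodes Q × SymClosure (λ c d → (c , d) ∈ arcs P) a b

      step-sym : Symmetric Step
      step-sym (p , q , fwd e) = q , p , bwd e
      step-sym (p , q , bwd e) = q , p , fwd e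

      forward : ∀ {h t y} → Linked (Adj T) (h ∷ t) → Unique (h ∷ t) → (∀ {x} → x ∈ h ∷ t → Bag x u) →
                (∀ {e} → e ∈ zip (h ∷ t) t → e ∈ arcs P) → h ∉ nodes Q → y ∈ t → y ∉ nodes Q → Star Step h y
      forward {h} {h′ ∷ t} (r ∷ lk) (hu ∷ us) on-u sub h∉ y∈ y∉ with _∈?_ _≟_ h′ (nodes Q) | y∈
      ... | no h′∉ | here refl = (h∉ , h′∉ , fwd (sub (here refl))) ◅ ε
      ... | no h′∉ | there y∈′ =
        (h∉ , h′∉ , fwd (sub (here refl))) ◅ forward lk us (on-u ∘ there) (sub ∘ there) h′∉ y∈′ y∉
      ... | yes h′∈ | here refl = ⊥-elim (y∉ h′∈)
      ... | yes h′∈ | there y∈′ =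
        ⊥-elim (y∉ (into (no-return u≢v (r ∷ lk) (hu ∷ us) on-u (h∉ ∘ into) (onto h′∈) y∈′)))

      along : ∀ {h t x y} → Linked (Adj T) (h ∷ t) → Unique (h ∷ t) → (∀ {x} → x ∈ h ∷ t → Bag x u) →
              (∀ {e} → e ∈ zip (h ∷ t) t → e ∈ arcs P) → Before x y (h ∷ t) → x ∉ nodes Q → y ∉ nodes Q →
              Star Step x y
      along lk us on-u sub (here y∈) x∉ y∉ = forward lk us on-u sub x∉ y∈ y∉
      along {t = _ ∷ _} (_ ∷ lk) (_ ∷ us) on-u sub (there x<y) x∉ y∉ =
        along lk us (on-u ∘ there) (sub ∘ there) x<y x∉ y∉

      connect : ∀ {x y} → x ∈ nodes P → x ∉ nodes Q → y ∈ nodes P → y ∉ nodes Q → Star Step x y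
      connect {x} {y} x∈ x∉ y∈ y∉ with x ≟ y
      ... | yes refl = ε
      ... | no x≢y with before-cmp x∈ y∈ x≢y
      ...   | inj₁ x<y = along (linked-adj _≟_ _ P) (distinct P) P⊆ id x<y x∉ y∉
      ...   | inj₂ y<x = Star.reverse step-sym (along (linked-adj _≟_ _ P) (distinct P) P⊆ id y<x y∉ x∉)

  -- The model read off the clique tree

  module _ (connected : Connected G) (clawFree : ClawFree G) (sunFree : 3-SunFree G)
           (simplicial : Simplicial G (allFin n) r) where

    private
      occupied : ∀ v → ∃[ x ] Bag x v
      occupied v =
        let x , K⊆x = cover (_≟ v) (λ {w} _ → spanning w) (λ { refl refl p → ⊥-elim (p refl) }) in x , K⊆x refl

      paths : ∀ v →
              Σ[ P ∈ DirectedPath (growth-tree growth) ]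
                    ((∀ {x} → Bag x v → x ∈ nodes P) × (∀ {x} → x ∈ nodes P → Bag x v))
      paths v = growth-path growth (λ x → bag? x v) (subtree v)
        (unbranched clawFree sunFree connected simplicial v) (occupied v)

      pathOf : ∀ v → DirectedPath (growth-tree growth)
      pathOf v = proj₁ (paths v)

      into : ∀ {v x} → Bag x v → x ∈ nodes (pathOf v)
      into {v} = proj₁ (proj₂ (paths v))

      onto : ∀ {v x} → x ∈ nodes (pathOf v) → Bag x v
      onto {v} = proj₂ (proj₂ (paths v))

    inhabited : ∀ x → ∃[ v ] Bag x v
    inhabited x with x ≟ top growth
    ... | yes refl = r , top-bag
    ... | no x≢top = let v , b , _ = difference x≢top in v , b

    clique-tree-model : PathDTreeModel G
    clique-tree-model = record
      { size = order
      ; tree = growth-tree growth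
      ; path = pathOf
      ; node-covered = λ x → let v , b = inhabited x in v , into b
      ; arc-covered = λ xy → let v , p , q = edge-meets connected (inj₁ xy) in
                             v , path-arc growth (pathOf v) (into p) (into q) xy
      ; intersection = λ u v u≢v → mk⇔
          (λ uv → let x , p , q = adj⇒Meet uv in x , into p , into q)
          (λ (x , p , q) → clique x (onto p) (onto q) u≢v)
      }

    model-NC : IsNC clique-tree-model
    model-NC u v u≢v = difference-connected clawFree u≢v (pathOf u) (pathOf v) onto into onto
                     , difference-connected clawFree (u≢v ∘ sym) (pathOf v) (pathOf u) onto into onto

    ∈-bag⁺ : ∀ {x v} → Bag x v → v Subset.∈ bag clique-tree-model x
    ∈-bag⁺ {x} {v} b with _∈?_ _≟_ x (nodes (pathOf v)) in eq
    ... | yes _ = lookup⇒[]= v _ (trans (lookup∘tabulate _ v) (cong does eq))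
    ... | no x∉ = ⊥-elim (x∉ (into b))

    ∈-bag⁻ : ∀ {x v} → v Subset.∈ bag clique-tree-model x → Bag x v
    ∈-bag⁻ {x} {v} v∈ with _∈?_ _≟_ x (nodes (pathOf v)) in eq
    ... | yes x∈ = onto x∈
    ... | no _ with trans (sym (cong does eq)) (trans (sym (lookup∘tabulate _ v)) ([]=⇒lookup v∈))
    ...   | ()

    covered : ∀ S → IsClique G S → ∃[ x ] S Subset.⊆ bag clique-tree-model x
    covered S S-clique =
      let x , S⊆x = cover (Subset._∈? S) (λ {w} _ → spanning w) S-clique in x , λ v∈ → ∈-bag⁺ (S⊆x v∈)

    bag-clique : ∀ x → IsClique G (bag clique-tree-model x)
    bag-clique x u∈ v∈ = clique x (∈-bag⁻ u∈) (∈-bag⁻ v∈)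

    bag-⊆ : ∀ {x y} → bag clique-tree-model x Subset.⊆ bag clique-tree-model y → x ≡ y
    bag-⊆ x⊆y = antichain λ b → ∈-bag⁻ (x⊆y (∈-bag⁺ b))

    model-clique-tree : IsCliqueTree clique-tree-model
    model-clique-tree = record
      { maximal = λ x → bag-clique x , maximal′ x
      ; injective = λ {x} {y} e → bag-⊆ λ {v} → subst (v Subset.∈_) e
      ; surjective = λ S (S-clique , S-max) → let x , S⊆x = covered S S-clique in x , S-max _ (bag-clique x) S⊆x
      }
      where
      maximal′ : ∀ x S → IsClique G S → bag clique-tree-model x Subset.⊆ S → S ≡ bag clique-tree-model x
      maximal′ x S S-clique x⊆S with covered S S-clique
      ... | y , S⊆y with bag-⊆ (λ v∈ → S⊆y (x⊆S v∈))
      ...   | refl = Subset.⊆-antisym S⊆y x⊆S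

forbidden⇒clique-tree : ∀ {n} {G : Graph (Fin n)} → Connected G → Chordal G → ClawFree G → 3-SunFree G →
                        HasNCPathRTreeCliqueTree G
forbidden⇒clique-tree {G = G} connected chordal clawFree sunFree =
  let r , simplicial , L , order , spanning = elimination-from-simplicial G chordal (proj₁ connected)
      C = clique-tree G order
  in clique-tree-model C spanning connected clawFree sunFree simplicial
   , growth-rooted (CliqueTree.growth C)
   , model-NC C spanning connected clawFree sunFree simplicial
   , model-clique-tree C spanning connected clawFree sunFree simplicial

-- Both equivalences pass through the forbidden subgraphs: any non-crossing model on a directed tree
-- excludes them, and their absence already yields the strongest kind of model.
theorem2 : ∀ (n : ℕ) (G : Graph (Fin n)) → Connected G →
    ((Chordal G × ClawFree G × 3-SunFree G) ⇔ IsNCPathRTreeGraph G)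
    × (HasNCPathDTreeModel G ⇔ HasNCPathRTreeCliqueTree G)
theorem2 n G connected =
    mk⇔ (λ forbidden → let M , rooted , nc , _ = construct forbidden in M , rooted , nc)
        (λ (M , _ , nc) → forbidden (M , nc))
  , mk⇔ (construct ∘ forbidden) (λ (M , _ , nc , _) → M , nc)
  where
  forbidden : HasNCPathDTreeModel G → Chordal G × ClawFree G × 3-SunFree G
  forbidden (M , nc) = model-chordal M , model-clawFree M nc , model-3-SunFree M

  construct : Chordal G × ClawFree G × 3-SunFree G → HasNCPathRTreeCliqueTree G
  construct (chordal , clawFree , sunFree) = forbidden⇒clique-tree connected chordal clawFree sunFree
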